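{- A graph class $\mathcal{C}$ is interpretable in a class of locally almost bounded degree by a bounded range interpretation (i.e. there exist a class $\mathcal{D}$ of locally almost bounded degree and an interpretation $I$ of bounded range with $\mathcal{C}\subseteq\{I(H):H\in\mathcal{D}\}$) if and only if $\mathcal{C}$ is locally almost near-covered.
   Context: Graphs are finite, simple, and may be colored by unary predicates; graph-theoretic properties refer to the underlying graph. $N^G(v)$ is the set of neighbors of $v$; $N_r^G(v)$ is the closed $r$-neighborhood of $v$ (vertices at distance at most $r$, including $v$); $\mathrm{dist}_G$ is graph distance. A class $\mathcal{D}$ has locally almost bounded degree if there exist $f,d:\mathbb{N}\to\mathbb{N}$ such that for every $r$, every $G\in\mathcal{D}$ and every $v\in V(G)$, $N_r^G(v)$ contains at most $f(r)$ vertices of degree larger than $d(r)$ in $G$. An interpretation $I=(\psi,\delta)$ consists of first-order formulas $\psi(x,y)$, $\delta(x)$ in the signature of (colored) graphs, $\psi$ symmetric and irreflexive; $I(G)$ has vertex set $\{v:G\models\delta(v)\}$ and edges $uv$ ($u\neq v$) with $G\models\psi(u,v)$. $\psi$ has range $b$ if for all graphs $G$ and $u,v\in V(G)$, $\mathrm{dist}_G(u,v)>b$ implies $G\not\models\psi(u,v)$; $I$ is of bounded range if $\psi$ has range $b$ for some $b$. Two vertices are $k$-near-twins in $G$ if $|N^G(u)\,\Delta\,N^G(v)|\le k$. $G$ is $(k,m)$-near-covered if every set of vertices that are pairwise not $k$-near-twins has size at most $m$. $\mathcal{C}$ is locally almost near-covered if there exist $k,m:\mathbb{N}\to\mathbb{N}$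 such that for every $r$, every $G\in\mathcal{C}$ and every $v\in V(G)$, the induced subgraph $G[N_r^G(v)]$ is $(k(r),m(r))$-near-covered. -}

module Defs where

open import Data.Bool.Base using (Bool; T)
open import Data.Empty using (⊥)
open import Data.Fin.Base using (Fin)
open import Data.Fin.Properties using (_≟_; any?; all?)
open import Data.Fin.Subset using (Subset; _∈_; _∩_; _∪_; _─_; ∣_∣)
open import Data.Fin.Subset.Properties using (_∈?_)
open import Data.List.Base using (List; length; filter; allFin)
import Data.List.Base as List
open import Data.Nat.Base using (ℕ; zero; suc; _≤_; s≤s; s≤s⁻¹)
open import Data.Nat.Properties using (_<?_; anyUpTo?)
open import Data.Product.Base using (Σ-syntax; ∃-syntax; _×_; map₁; map₂)
open import Data.Sum.Base using (_⊎_)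
open import Data.Vec.Base using (Vec; []; _∷_; lookup; tabulate)
open import Function.Bundles using (_↔_; _⇔_; Inverse)
open import Level using (Level; 0ℓ) renaming (suc to lsuc)
open import Relation.Binary.Core using (Rel)
open import Relation.Binary.Definitions using (Symmetric; Irreflexive) renaming (Decidable to Decidable₂)
open import Relation.Binary.PropositionalEquality using (_≡_; _≢_; refl)
open import Relation.Nullary using (¬_; Dec; no; does)
open import Relation.Nullary.Decidable using (⌊_⌋; toWitness; fromWitness; T?; map′; ¬?; _×-dec_; _⊎-dec_)
open import Relation.Unary using (Pred; Decidable)

-- Adjacency is Boolean-valued, so that Graph lives in Set and all notions
-- below are decidable.
record Graph : Set where
  field
    order : ℕ

  Vertex : Set
  Vertex = Fin order

  field
    adj : Vertex → Vertex → Bool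

  Adj : Rel Vertex 0ℓ
  Adj u v = T (adj u v)

  field
    Adj-sym    : Symmetric Adj
    Adj-irrefl : Irreflexive _≡_ Adj

-- Colors are arbitrary unary predicates: a vertex may carry any number of them.
record ColoredGraph (p : ℕ) : Set where
  field
    graph : Graph

  open Graph graph public

  field
    color : Fin p → Subset order

open ColoredGraph using (graph)

GraphClass : (ℓ : Level) → Set (lsuc ℓ)
GraphClass ℓ = Pred Graph ℓ

ColoredGraphClass : (p : ℕ) (ℓ : Level) → Set (lsuc ℓ)
ColoredGraphClass p ℓ = Pred (ColoredGraph p) ℓ

infix 4 _≅_

_≅_ : Graph → Graph → Set
G ≅ H = Σ[ f ∈ G.Vertex ↔ H.Vertex ]
          (∀ u v → G.Adj u v ⇔ H.Adj (Inverse.to f u) (Inverse.to f v))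
  where
  module G = Graph G
  module H = Graph H

subset : ∀ {n} {P : Pred (Fin n) 0ℓ} → Decidable P → Subset n
subset P? = tabulate (λ x → does (P? x))

-- The graph whose vertices are the x : Fin n satisfying P and whose edges are
-- given by E.  Its vertices are renumbered in increasing order: vertex i stands
-- for the i-th element of Fin n satisfying P.
graphOn : ∀ {n} {P : Pred (Fin n) 0ℓ} {E : Rel (Fin n) 0ℓ} →
          Decidable P → Decidable₂ E →
          Symmetric E → Irreflexive _≡_ E → Graph
graphOn {n} {P} {E} P? E? E-sym E-irrefl = record
  { order      = length vertices
  ; adj        = λ i j → ⌊ E? (at i) (at j) ⌋
  ; Adj-sym    = λ {i} {j} e →
                   fromWitness {a? = E? (at j) (at i)}
                     (E-sym (toWitness {a? = E? (at i) (at j)} e))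
  ; Adj-irrefl = λ { {i} refl e →
                   E-irrefl refl (toWitness {a? = E? (at i) (at i)} e) }
  }
  where
  vertices : List (Fin n)
  vertices = filter P? (allFin n)

  at : Fin (length vertices) → Fin n
  at = List.lookup vertices

module _ (G : Graph) where
  open Graph G

  Walk : ℕ → Rel Vertex 0ℓ
  Walk zero    u v = u ≡ v
  Walk (suc l) u v = ∃[ w ] (Adj u w × Walk l w v)

  -- dist(u,v) ≤ r; the distance is infinite if there is no walk.
  Dist≤ : ℕ → Rel Vertex 0ℓ
  Dist≤ r u v = ∃[ l ] (l ≤ r × Walk l u v)

  Dist> : ℕ → Rel Vertex 0ℓ
  Dist> r u v = ¬ Dist≤ r u v

  walk? : ∀ l → Decidable₂ (Walk l)
  walk? zero    u v = u ≟ v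
  walk? (suc l) u v = any? (λ w → T? (adj u w) ×-dec walk? l w v)

  dist≤? : ∀ r → Decidable₂ (Dist≤ r)
  dist≤? r u v = map′ (map₂ (map₁ s≤s⁻¹)) (map₂ (map₁ s≤s))
                      (anyUpTo? (λ l → walk? l u v) (suc r))

  neighbors : Vertex → Subset order
  neighbors v = tabulate (adj v)

  degree : Vertex → ℕ
  degree v = ∣ neighbors v ∣

  ball : ℕ → Vertex → Subset order
  ball r v = subset (dist≤? r v)

  degreeAbove : ℕ → Subset order
  degreeAbove d = subset (λ v → d <? degree v)

  induced : Subset order → Graph
  induced S = graphOn (_∈? S) (λ u v → T? (adj u v)) Adj-sym Adj-irrefl

  NearTwins : ℕ → Rel Vertex 0ℓ
  NearTwins k u v = ∣ (neighbors u ─ neighbors v) ∪ (neighbors v ─ neighbors u) ∣ ≤ k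

  NearCovered : ℕ → ℕ → Set
  NearCovered k m = (S : Subset order) →
    (∀ u v → u ∈ S → v ∈ S → u ≢ v → ¬ NearTwins k u v) →
    ∣ S ∣ ≤ m

LocallyAlmostBoundedDegree : ∀ {p ℓ} → ColoredGraphClass p ℓ → Set ℓ
LocallyAlmostBoundedDegree D =
  Σ[ f ∈ (ℕ → ℕ) ] Σ[ d ∈ (ℕ → ℕ) ]
    (∀ r H → D H → ∀ v →
      ∣ ball (graph H) r v ∩ degreeAbove (graph H) (d r) ∣ ≤ f r)

LocallyAlmostNearCovered : ∀ {ℓ} → GraphClass ℓ → Set ℓ
LocallyAlmostNearCovered C =
  Σ[ k ∈ (ℕ → ℕ) ] Σ[ m ∈ (ℕ → ℕ) ]
    (∀ r G → C G → ∀ v → NearCovered (induced G (ball G r v)) (k r) (m r))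

-- First-order formulas over graphs with p unary predicates and with n free
-- variables, as de Bruijn indices; a quantifier binds index zero.
data Formula (p : ℕ) : ℕ → Set where
  ⊥ᶠ      : ∀ {n} → Formula p n
  _≐_     : ∀ {n} → Fin n → Fin n → Formula p n
  edge    : ∀ {n} → Fin n → Fin n → Formula p n
  colored : ∀ {n} → Fin p → Fin n → Formula p n
  ¬ᶠ_     : ∀ {n} → Formula p n → Formula p n
  _∧ᶠ_    : ∀ {n} → Formula p n → Formula p n → Formula p n
  _∨ᶠ_    : ∀ {n} → Formula p n → Formula p n → Formula p n
  ∃ᶠ_     : ∀ {n} → Formula p (suc n) → Formula p n
  ∀ᶠ_     : ∀ {n} → Formula p (suc n) → Formula p n

module _ {p : ℕ} (H : ColoredGraph p) where
  open ColoredGraph H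

  infix 4 _⊨_ _⊨?_

  _⊨_ : ∀ {n} → Vec Vertex n → Formula p n → Set
  ρ ⊨ ⊥ᶠ          = ⊥
  ρ ⊨ (i ≐ j)     = lookup ρ i ≡ lookup ρ j
  ρ ⊨ edge i j    = Adj (lookup ρ i) (lookup ρ j)
  ρ ⊨ colored c i = lookup ρ i ∈ color c
  ρ ⊨ (¬ᶠ φ)      = ¬ (ρ ⊨ φ)
  ρ ⊨ (φ ∧ᶠ χ)    = (ρ ⊨ φ) × (ρ ⊨ χ)
  ρ ⊨ (φ ∨ᶠ χ)    = (ρ ⊨ φ) ⊎ (ρ ⊨ χ)
  ρ ⊨ (∃ᶠ φ)      = ∃[ a ] (a ∷ ρ ⊨ φ)
  ρ ⊨ (∀ᶠ φ)      = ∀ a → a ∷ ρ ⊨ φ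

  _⊨?_ : ∀ {n} (ρ : Vec Vertex n) (φ : Formula p n) → Dec (ρ ⊨ φ)
  ρ ⊨? ⊥ᶠ          = no λ ()
  ρ ⊨? (i ≐ j)     = lookup ρ i ≟ lookup ρ j
  ρ ⊨? edge i j    = T? (adj (lookup ρ i) (lookup ρ j))
  ρ ⊨? colored c i = lookup ρ i ∈? color c
  ρ ⊨? (¬ᶠ φ)      = ¬? (ρ ⊨? φ)
  ρ ⊨? (φ ∧ᶠ χ)    = (ρ ⊨? φ) ×-dec (ρ ⊨? χ)
  ρ ⊨? (φ ∨ᶠ χ)    = (ρ ⊨? φ) ⊎-dec (ρ ⊨? χ)
  ρ ⊨? (∃ᶠ φ)      = any? (λ a → a ∷ ρ ⊨? φ)
  ρ ⊨? (∀ᶠ φ)      = all? (λ a → a ∷ ρ ⊨? φ)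

  Sat₁ : Formula p 1 → Pred Vertex 0ℓ
  Sat₁ δ v = v ∷ [] ⊨ δ

  Sat₂ : Formula p 2 → Rel Vertex 0ℓ
  Sat₂ ψ u v = u ∷ v ∷ [] ⊨ ψ

  sat₁? : ∀ δ → Decidable (Sat₁ δ)
  sat₁? δ v = v ∷ [] ⊨? δ

  sat₂? : ∀ ψ → Decidable₂ (Sat₂ ψ)
  sat₂? ψ u v = u ∷ v ∷ [] ⊨? ψ

record Interpretation (p : ℕ) : Set where
  field
    ψ        : Formula p 2
    δ        : Formula p 1
    ψ-sym    : (H : ColoredGraph p) → Symmetric (Sat₂ H ψ)
    ψ-irrefl : (H : ColoredGraph p) → Irreflexive _≡_ (Sat₂ H ψ)

interpret : ∀ {p} → Interpretation p → ColoredGraph p → Graph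
interpret I H = graphOn (sat₁? H δ) (sat₂? H ψ) (ψ-sym H) (ψ-irrefl H)
  where open Interpretation I

HasRange : ∀ {p} → Formula p 2 → ℕ → Set
HasRange {p} ψ b = (H : ColoredGraph p) → ∀ u v →
  Dist> (graph H) b u v → ¬ Sat₂ H ψ u v

BoundedRange : ∀ {p} → Interpretation p → Set
BoundedRange I = ∃[ b ] HasRange (Interpretation.ψ I) b

{-# OPTIONS --safe #-}
module Submission where

open import Defs
open import Data.Bool.Base using (Bool; true; false; T)
import Data.Bool.Properties as Bool
open import Data.Empty using (⊥-elim)
open import Data.Fin.Base using (Fin; zero; suc; toℕ; fromℕ<; splitAt; join)
open import Data.Fin.Patterns using (0F; 1F; 2F; 3F)
import Data.Fin.Properties as Fin
open import Data.Fin.Subset using (Subset; inside; outside; ∣_∣; _─_; _∪_; _∩_) renaming (_∈_ to _∈ˢ_; _∉_ to _∉ˢ_)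
open import Data.Fin.Subset.Properties using (x∈p∩q⁺; x∈p∩q⁻; x∈p∪q⁺; x∈p∪q⁻) renaming (_∈?_ to _∈ˢ?_)
open import Data.List.Base using (List; []; _∷_; [_]; _++_; map; filter; length; lookup; concatMap; take; allFin; cartesianProductWith)
open import Data.List.Membership.Propositional using (_∈_; find; lose)
open import Data.List.Membership.Propositional.Properties
  using (∈-map⁺; ∈-map⁻; ∈-++⁺ˡ; ∈-++⁺ʳ; ∈-concatMap⁺; ∈-filter⁺; ∈-filter⁻; ∈-lookup; ∈-allFin; ∈-cartesianProductWith⁺)
open import Data.List.Properties using (length-map; length-++; length-take)
open import Data.List.Relation.Unary.All as All using (All)
import Data.List.Relation.Unary.All.Properties as All
open import Data.List.Relation.Unary.AllPairs using ([]; _∷_)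
open import Data.List.Relation.Unary.Any as Any using (Any; here; there)
open import Data.List.Relation.Unary.Any.Properties using (lookup-index)
open import Data.List.Relation.Unary.Unique.Propositional using (Unique)
import Data.List.Relation.Unary.Unique.Propositional.Properties as Unique
open import Data.Nat.Base using (ℕ; zero; suc; _+_; _*_; _≤_; _<_; z≤n; s≤s)
open import Data.Nat.Properties
  using (≤-refl; ≤-trans; ≤-reflexive; <⇒≤; <⇒≱; ≰⇒>; 1+n≰n; n≤1+n; m≤m+n; m≤n+m; m≤n*m; +-comm; +-assoc; +-mono-≤; +-monoʳ-≤; *-identityʳ; *-mono-≤; *-monoˡ-≤; *-monoʳ-≤; m≤n⇒m⊓n≡m; _≤?_; _<?_)
open import Data.Product.Base using (Σ-syntax; ∃-syntax; _×_; _,_; proj₁; proj₂)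
open import Data.Sum.Base as Sum using (_⊎_; inj₁; inj₂)
open import Data.Sum.Properties using (inj₁-injective; inj₂-injective)
open import Data.Unit.Base using (⊤; tt)
open import Data.Vec.Base as Vec using (Vec; []; _∷_; here; there)
open import Data.Vec.Properties using ([]=⇒lookup; lookup⇒[]=; lookup∘tabulate; ≡-dec)
open import Function.Base using (_∘_; id)
open import Function.Bundles using (_⇔_; mk⇔; mk↔ₛ′; Equivalence; Injection; Inverse)
open import Function.Properties.Inverse using (↔⇒↣)
open import Level using (Level; 0ℓ)
open import Relation.Binary.Core using (Rel)
open import Relation.Binary.Definitions using (Symmetric; Irreflexive) renaming (Decidable to Decidable₂)
open import Relation.Binary.PropositionalEquality using (_≡_; _≢_; refl; sym; trans; cong; subst; subst₂; ≢-sym)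
open import Relation.Nullary using (¬_; Dec; yes; no; does)
open import Relation.Nullary.Decidable using (map′; ¬?; _×-dec_; _⊎-dec_; T?; ⌊_⌋; toWitness; fromWitness; dec-true; decidable-stable)
open import Relation.Unary using (Decidable)

-- (⇒) Let S be the vertices of large degree in a big ball of H.  A vertex u is
-- described by the finite isomorphism type of its ball in H − S, together with
-- the adjacencies to S.  If two vertices have equal descriptions and disjoint
-- balls, then exchanging the balls is a winning strategy in the
-- Ehrenfeucht–Fraïssé game as long as the other vertices stay away from them,
-- so ψ distinguishes the two vertices only inside the balls.
--
-- (⇐) Group the vertices of degree more than k₀ around a maximal set of
-- pairwise non-near-twins.  Between two large classes G is almost complete or
-- almost empty, so complementing the almost complete pairs leaves few edges.
-- A new hub vertex for each large class remembers its members and, by edges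
-- between hubs, the complemented pairs.  Since k-near-twins of degree more
-- than k have a common neighbour, all vertices of large degree in a ball lie
-- around boundedly many vertices, near each of which there are few classes.

-- Counting finite sets by covering lists.

private variable
  A B : Set
  m n k : ℕ
  ℓ : Level

lookup-injective : {xs : List A} → Unique xs → ∀ i j → lookup xs i ≡ lookup xs j → i ≡ j
lookup-injective (_   ∷ _)  zero    zero    _  = refl
lookup-injective (x∉ ∷ _)  zero    (suc j) eq = ⊥-elim (All.lookup x∉ (∈-lookup j) eq)
lookup-injective (x∉ ∷ _)  (suc i) zero    eq = ⊥-elim (All.lookup x∉ (∈-lookup i) (sym eq))
lookup-injective (_   ∷ xs!) (suc i) (suc j) eq = cong suc (lookup-injective xs! i j eq)

length-mono : {xs ys : List A} → Unique xs → (∀ {x} → x ∈ xs → x ∈ ys) → length xs ≤ length ys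
length-mono {xs = xs} {ys} xs! xs⊆ys = Fin.injective⇒≤ {f = position} position-injective
  where
  position : Fin (length xs) → Fin (length ys)
  position i = Any.index (xs⊆ys (∈-lookup i))

  position-injective : ∀ {i j} → position i ≡ position j → i ≡ j
  position-injective {i} {j} eq = lookup-injective xs! i j
    (trans (lookup-index (xs⊆ys (∈-lookup i)))
      (trans (cong (lookup ys) eq) (sym (lookup-index (xs⊆ys (∈-lookup j))))))

-- Cov P m says that at most m elements satisfy P.  The list may contain other
-- elements, so that passing to a smaller predicate needs no decidability.
record Cov (P : A → Set) (m : ℕ) : Set where
  constructor cov
  field
    list   : List A
    length≤ : length list ≤ m
    covers : ∀ {x} → P x → x ∈ list

open Cov

cov-mono : {P Q : A → Set} → (∀ {x} → Q x → P x) → m ≤ n → Cov P m → Cov Q n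
cov-mono Q⊆P m≤n (cov xs l c) = cov xs (≤-trans l m≤n) (c ∘ Q⊆P)

cov-⊆ : {P Q : A → Set} → (∀ {x} → Q x → P x) → Cov P m → Cov Q m
cov-⊆ Q⊆P = cov-mono Q⊆P ≤-refl

cov-≤ : {P : A → Set} → m ≤ n → Cov P m → Cov P n
cov-≤ = cov-mono id

cov-∅ : {P : A → Set} → (∀ {x} → ¬ P x) → Cov P m
cov-∅ ¬P = cov [] z≤n (⊥-elim ∘ ¬P)

cov-∪ : {P Q R : A → Set} → (∀ {x} → R x → P x ⊎ Q x) → Cov P m → Cov Q n → Cov R (m + n)
cov-∪ {R = R} split (cov xs l c) (cov ys l′ c′) =
  cov (xs ++ ys) (subst (_≤ _) (sym (length-++ xs)) (+-mono-≤ l l′)) (λ r → both (split r))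
  where
  both : ∀ {x} → _ ⊎ _ → x ∈ xs ++ ys
  both (inj₁ p) = ∈-++⁺ˡ (c p)
  both (inj₂ q) = ∈-++⁺ʳ xs (c′ q)

cov-∈ : (xs : List A) → Cov (_∈ xs) (length xs)
cov-∈ xs = cov xs ≤-refl id

cov-map : {P : A → Set} (f : A → B) → Cov P m → Cov (λ y → ∃[ x ] (P x × y ≡ f x)) m
cov-map f (cov xs l c) =
  cov (map f xs) (subst (_≤ _) (sym (length-map f xs)) l) (λ { (x , p , refl) → ∈-map⁺ f (c p) })

concatMap-length : (f : A → List B) (xs : List A) → (∀ x → length (f x) ≤ k) →
                   length (concatMap f xs) ≤ length xs * k
concatMap-length f []       _ = z≤n
concatMap-length f (x ∷ xs) l =
  subst (_≤ _) (sym (length-++ (f x))) (+-mono-≤ (l x) (concatMap-length f xs l))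

-- The list covering `P` may contain elements outside `P`, which have no cover of their own;
-- deciding `P` lets them contribute nothing.
cov-bind : {P : A → Set} {Q : A → B → Set} → Decidable P → Cov P m →
           (∀ x → P x → Cov (Q x) k) → Cov (λ y → ∃[ x ] (P x × Q x y)) (m * k)
cov-bind {k = k} {P = P} {Q} P? (cov xs l c) covQ =
  cov (concatMap fibre xs)
      (≤-trans (concatMap-length fibre xs fibre-length) (*-mono-≤ l ≤-refl))
      (λ { (x , p , q) → ∈-concatMap⁺ fibre (lose (c p) (fibre-∈ x p q)) })
  where
  fibre : _ → List _
  fibre x with P? x
  ... | yes p = list (covQ x p)
  ... | no  _ = []

  fibre-length : ∀ x → length (fibre x) ≤ k
  fibre-length x with P? x
  ... | yes p = length≤ (covQ x p)
  ... | no  _ = z≤n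

  fibre-∈ : ∀ x → P x → ∀ {y} → Q x y → y ∈ fibre x
  fibre-∈ x p q with P? x
  ... | yes p′ = covers (covQ x p′) q
  ... | no ¬p  = ⊥-elim (¬p p)

cov-unique : {P : A → Set} {xs : List A} → Unique xs → All P xs → Cov P m → length xs ≤ m
cov-unique xs! all (cov ys l c) = ≤-trans (length-mono xs! (λ x∈ → c (All.lookup all x∈))) l

module _ {P : Fin n → Set} (P? : Decidable P) where

  private
    elements : List (Fin n)
    elements = filter P? (allFin n)

    elements! : Unique elements
    elements! = Unique.filter⁺ P? (Unique.allFin⁺ n)

    elements-all : All P elements
    elements-all = All.all-filter P? (allFin n)

  abstract
    -- The duplicate-free list of all elements of `P` is a shortest possible cover, so its length
    -- decides.
    cov? : ∀ m → Dec (Cov P m)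
    cov? m = map′ (λ l → cov elements l (λ p → ∈-filter⁺ P? (∈-allFin _) p))
                  (cov-unique elements! elements-all)
                  (length elements ≤? m)

  filter-length : Cov P m → length (filter P? (allFin n)) ≤ m
  filter-length = cov-unique elements! elements-all

  many : ¬ Cov P m → Σ[ xs ∈ List (Fin n) ] (Unique xs × All P xs × length xs ≡ suc m)
  many {m = m} ¬c =
    take (suc m) elements , Unique.take⁺ (suc m) elements! , All.take⁺ (suc m) elements-all ,
    trans (length-take (suc m) elements) (m≤n⇒m⊓n≡m (≰⇒> (λ l → ¬c
      (cov elements l (λ p → ∈-filter⁺ P? (∈-allFin _) p)))))

  some : ¬ Cov P m → ∃[ x ] P x
  some ¬c with Fin.any? P?
  ... | yes e = e
  ... | no ¬e = ⊥-elim (¬c (cov-∅ (λ p → ¬e (_ , p))))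

members : Subset n → List (Fin n)
members []            = []
members (inside  ∷ S) = zero ∷ map suc (members S)
members (outside ∷ S) = map suc (members S)

length-members : (S : Subset n) → length (members S) ≡ ∣ S ∣
length-members []            = refl
length-members (inside  ∷ S) = cong suc (trans (length-map suc (members S)) (length-members S))
length-members (outside ∷ S) = trans (length-map suc (members S)) (length-members S)

∈-members⁺ : (S : Subset n) → ∀ {x} → x ∈ˢ S → x ∈ members S
∈-members⁺ (inside  ∷ S) here       = here refl
∈-members⁺ (inside  ∷ S) (there x∈) = there (∈-map⁺ suc (∈-members⁺ S x∈))
∈-members⁺ (outside ∷ S) (there x∈) = ∈-map⁺ suc (∈-members⁺ S x∈)

∈-members⁻ : (S : Subset n) → ∀ {x} → x ∈ members S → x ∈ˢ S
∈-members⁻ (inside  ∷ S) (here refl) = here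
∈-members⁻ (inside  ∷ S) (there x∈) with ∈-map⁻ suc x∈
... | _ , y∈ , refl = there (∈-members⁻ S y∈)
∈-members⁻ (outside ∷ S) x∈ with ∈-map⁻ suc x∈
... | _ , y∈ , refl = there (∈-members⁻ S y∈)

members-unique : (S : Subset n) → Unique (members S)
members-unique []            = []
members-unique (inside  ∷ S) =
  All.map⁺ (All.universal (λ _ ()) (members S)) ∷ Unique.map⁺ Fin.suc-injective (members-unique S)
members-unique (outside ∷ S) = Unique.map⁺ Fin.suc-injective (members-unique S)

∣∣⇒cov : (S : Subset n) → ∣ S ∣ ≤ m → Cov (_∈ˢ S) m
∣∣⇒cov S l = cov (members S) (subst (_≤ _) (sym (length-members S)) l) (∈-members⁺ S)

cov⇒∣∣ : (S : Subset n) → Cov (_∈ˢ S) m → ∣ S ∣ ≤ m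
cov⇒∣∣ S c = subst (_≤ _) (length-members S)
  (cov-unique (members-unique S) (All.tabulate (∈-members⁻ S)) c)

-- By injectivity each covered point has at most one preimage.
cov-preimage : {P : B → Set} → Decidable P → (∀ (x y : B) → Dec (x ≡ y)) → (f : Fin n → B) →
               (∀ {i j} → f i ≡ f j → i ≡ j) → Cov P m → Cov (λ i → P (f i)) m
cov-preimage {m = m} P? _≟_ f f-injective c =
  cov-mono (λ p → _ , p , refl) (≤-reflexive (*-identityʳ m)) (cov-bind P? c (λ y _ → fibre y))
  where
  fibre : ∀ y → Cov (λ i → f i ≡ y) 1
  fibre y with Fin.any? (λ i → f i ≟ y)
  ... | yes (i , refl) = cov [ i ] ≤-refl (λ eq → here (f-injective eq))
  ... | no ¬e          = cov-∅ (λ eq → ¬e (_ , eq))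

-- Greedy maximal independent sets.

record MaximalIndependent (T : A → A → Set) (Q : A → Set) : Set where
  field
    chosen      : List A
    chosen-Q    : ∀ {x} → x ∈ chosen → Q x
    independent : ∀ {x y} → x ∈ chosen → y ∈ chosen → x ≢ y → ¬ T x y
    maximal     : ∀ {x} → Q x → ∃[ y ] (y ∈ chosen × T x y)

module _ {T : Fin n → Fin n → Set} {Q : Fin n → Set}
         (T? : ∀ x y → Dec (T x y)) (Q? : Decidable Q)
         (T-refl : ∀ x → T x x) (T-sym : ∀ {x y} → T x y → T y x) where

  private
    Greedy : List (Fin n) → List (Fin n) → Set
    Greedy xs ys = (∀ {y} → y ∈ ys → Q y)
      × (∀ {x y} → x ∈ ys → y ∈ ys → x ≢ y → ¬ T x y)
      × (∀ {x} → x ∈ xs → Q x → ∃[ y ] (y ∈ ys × T x y))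

    -- An element is kept exactly when it satisfies `Q` and is `T`-related to none kept before, so a
    -- rejected element of `Q` has a `T`-partner among the kept ones.
    greedy : (xs : List (Fin n)) → ∃[ ys ] Greedy xs ys
    greedy [] = [] , (λ ()) , (λ ()) , λ ()
    greedy (x ∷ xs) with greedy xs
    ... | ys , ys-Q , ind , max with Q? x
    ...   | no ¬q = ys , ys-Q , ind ,
                    λ { (here refl) q → ⊥-elim (¬q q) ; (there x∈) q → max x∈ q }
    ...   | yes q with Any.any? (T? x) ys
    ...     | yes t = ys , ys-Q , ind , λ { (here refl) _ → find t ; (there x∈) q → max x∈ q }
    ...     | no ¬t = x ∷ ys
                    , (λ { (here refl) → q ; (there y∈) → ys-Q y∈ })
                    , (λ { (here refl) (here refl) x≢y _ → x≢y refl
                         ; (here refl) (there y∈) _ t → ¬t (lose y∈ t)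
                         ; (there x∈) (here refl) _ t → ¬t (lose x∈ (T-sym t))
                         ; (there x∈) (there y∈) → ind x∈ y∈ })
                    , λ { (here refl) _ → x , here refl , T-refl x
                        ; (there x∈) q′ → let y , y∈ , t = max x∈ q′ in y , there y∈ , t }

  maximalIndependent : MaximalIndependent T Q
  maximalIndependent with greedy (allFin n)
  ... | ys , ys-Q , ind , max = record
    { chosen = ys ; chosen-Q = ys-Q ; independent = ind ; maximal = max (∈-allFin _) }

-- Distances, near-twins and induced subgraphs

∈-tabulate⁺ : (f : Fin n → Bool) → ∀ {x} → T (f x) → x ∈ˢ Vec.tabulate f
∈-tabulate⁺ f {x} t = lookup⇒[]= x _ (trans (lookup∘tabulate f x) (Equivalence.to Bool.T-≡ t))

∈-tabulate⁻ : (f : Fin n → Bool) → ∀ {x} → x ∈ˢ Vec.tabulate f → T (f x)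
∈-tabulate⁻ f {x} x∈ = Equivalence.from Bool.T-≡ (trans (sym (lookup∘tabulate f x)) ([]=⇒lookup x∈))

module _ {P : Fin n → Set} (P? : Decidable P) where

  ∈-subset⁺ : ∀ {x} → P x → x ∈ˢ subset P?
  ∈-subset⁺ {x} p = ∈-tabulate⁺ (does ∘ P?) (Equivalence.from Bool.T-≡ (dec-true (P? x) p))

  ∈-subset⁻ : ∀ {x} → x ∈ˢ subset P? → P x
  ∈-subset⁻ {x} x∈ with P? x | ∈-tabulate⁻ (does ∘ P?) x∈
  ... | yes p | _ = p

∈-─⁺ : ∀ {p q : Subset n} {x} → x ∈ˢ p → x ∉ˢ q → x ∈ˢ p ─ q
∈-─⁺ {q = outside ∷ _} here       _   = here
∈-─⁺ {q = inside  ∷ _} here       x∉ = ⊥-elim (x∉ here)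
∈-─⁺ {q = _ ∷ _}       (there x∈) x∉ = there (∈-─⁺ x∈ (x∉ ∘ there))

∈-─⁻ : ∀ (p q : Subset n) {x} → x ∈ˢ p ─ q → x ∈ˢ p × x ∉ˢ q
∈-─⁻ (_ ∷ _) (outside ∷ _) here       = here , λ ()
∈-─⁻ (_ ∷ p) (_ ∷ q)       (there x∈) with ∈-─⁻ p q x∈
... | x∈p , x∉q = there x∈p , λ { (there x∈q) → x∉q x∈q }

module _ {P : Fin n → Set} (P? : Decidable P) where

  vertexAt : Fin (length (filter P? (allFin n))) → Fin n
  vertexAt = lookup (filter P? (allFin n))

  vertexAt-P : ∀ i → P (vertexAt i)
  vertexAt-P i = proj₂ (∈-filter⁻ P? {xs = allFin n} (∈-lookup i))

  vertexAt-injective : ∀ {i j} → vertexAt i ≡ vertexAt j → i ≡ j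
  vertexAt-injective = lookup-injective (Unique.filter⁺ P? (Unique.allFin⁺ n)) _ _

  vertexAt-surjective : ∀ {x} → P x → ∃[ i ] vertexAt i ≡ x
  vertexAt-surjective {x} p = Any.index x∈ , sym (lookup-index x∈)
    where
    x∈ : x ∈ filter P? (allFin n)
    x∈ = ∈-filter⁺ P? (∈-allFin x) p

  module _ {E : Rel (Fin n) 0ℓ} (E? : Decidable₂ E) (E-sym : Symmetric E) (E-irrefl : Irreflexive _≡_ E) where

    graphOn-Adj⁺ : ∀ i j → E (vertexAt i) (vertexAt j) → Graph.Adj (graphOn P? E? E-sym E-irrefl) i j
    graphOn-Adj⁺ i j = fromWitness {a? = E? (vertexAt i) (vertexAt j)}

    graphOn-Adj⁻ : ∀ i j → Graph.Adj (graphOn P? E? E-sym E-irrefl) i j → E (vertexAt i) (vertexAt j)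
    graphOn-Adj⁻ i j = toWitness {a? = E? (vertexAt i) (vertexAt j)}

module _ (G : Graph) where
  open Graph G

  adj? : Decidable₂ Adj
  adj? u v = T? (adj u v)

  walk-trans : ∀ {k l u v w} → Walk G k u v → Walk G l v w → Walk G (k + l) u w
  walk-trans {zero}  refl        q = q
  walk-trans {suc k} (x , e , p) q = x , e , walk-trans p q

  walk-sym : ∀ {l u v} → Walk G l u v → Walk G l v u
  walk-sym {zero}  refl = refl
  walk-sym {suc l} {u} {v} (x , e , p) =
    subst (λ n → Walk G n v u) (+-comm l 1) (walk-trans (walk-sym p) (u , Adj-sym e , refl))

  dist-refl : ∀ {u} → Dist≤ G 0 u u
  dist-refl = 0 , z≤n , refl

  dist-adj : ∀ {u v} → Adj u v → Dist≤ G 1 u v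
  dist-adj e = 1 , ≤-refl , _ , e , refl

  dist-mono : ∀ {r r′ u v} → r ≤ r′ → Dist≤ G r u v → Dist≤ G r′ u v
  dist-mono r≤r′ (l , l≤r , p) = l , ≤-trans l≤r r≤r′ , p

  dist-trans : ∀ {r r′ u v w} → Dist≤ G r u v → Dist≤ G r′ v w → Dist≤ G (r + r′) u w
  dist-trans (k , k≤r , p) (l , l≤r′ , q) = k + l , +-mono-≤ k≤r l≤r′ , walk-trans p q

  dist-sym : ∀ {r u v} → Dist≤ G r u v → Dist≤ G r v u
  dist-sym (l , l≤r , p) = l , l≤r , walk-sym p

  ∈-neighbors⁺ : ∀ {u v} → Adj u v → v ∈ˢ neighbors G u
  ∈-neighbors⁺ {u} = ∈-tabulate⁺ (adj u)

  ∈-neighbors⁻ : ∀ {u v} → v ∈ˢ neighbors G u → Adj u v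
  ∈-neighbors⁻ {u} = ∈-tabulate⁻ (adj u)

  degree⇒cov : ∀ {u d} → degree G u ≤ d → Cov (Adj u) d
  degree⇒cov {u} l = cov-⊆ ∈-neighbors⁺ (∣∣⇒cov (neighbors G u) l)

  cov⇒degree : ∀ {u d} → Cov (Adj u) d → degree G u ≤ d
  cov⇒degree {u} c = cov⇒∣∣ (neighbors G u) (cov-⊆ ∈-neighbors⁻ c)

  ∈-degreeAbove⁺ : ∀ {u d} → ¬ Cov (Adj u) d → u ∈ˢ degreeAbove G d
  ∈-degreeAbove⁺ {d = d} ¬c = ∈-subset⁺ (λ v → d <? degree G v) (≰⇒> (¬c ∘ degree⇒cov))

  ∈-degreeAbove⁻ : ∀ {u d} → u ∈ˢ degreeAbove G d → ¬ Cov (Adj u) d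
  ∈-degreeAbove⁻ {d = d} u∈ c = <⇒≱ (∈-subset⁻ (λ v → d <? degree G v) u∈) (cov⇒degree c)

  Diff : Vertex → Vertex → Vertex → Set
  Diff u v w = (Adj u w × ¬ Adj v w) ⊎ (Adj v w × ¬ Adj u w)

  diff? : ∀ u v → Decidable (Diff u v)
  diff? u v w = (adj? u w ×-dec ¬? (adj? v w)) ⊎-dec (adj? v w ×-dec ¬? (adj? u w))

  -- The covering form of near-twins; `nearTwins⇒twins` and `twins⇒nearTwins` translate to and from
  -- cardinalities.
  Twins : ℕ → Vertex → Vertex → Set
  Twins k u v = Cov (Diff u v) k

  twins? : ∀ k u v → Dec (Twins k u v)
  twins? k u v = cov? (diff? u v) k

  twins-refl : ∀ {k} u → Twins k u u
  twins-refl u = cov-∅ λ { (inj₁ (e , ¬e)) → ¬e e ; (inj₂ (e , ¬e)) → ¬e e }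

  twins-sym : ∀ {k u v} → Twins k u v → Twins k v u
  twins-sym = cov-⊆ Sum.swap

  -- A vertex that distinguishes u from w distinguishes v from one of them, so the bounds add up.
  twins-trans : ∀ {k l u v w} → Twins k u v → Twins l v w → Twins (k + l) u w
  twins-trans {u = u} {v} {w} = cov-∪ split
    where
    split : ∀ {x} → Diff u w x → Diff u v x ⊎ Diff v w x
    split {x} (inj₁ (e , ¬e)) with adj? v x
    ... | yes f = inj₂ (inj₁ (f , ¬e))
    ... | no ¬f = inj₁ (inj₁ (e , ¬f))
    split {x} (inj₂ (e , ¬e)) with adj? v x
    ... | yes f = inj₁ (inj₂ (f , ¬e))
    ... | no ¬f = inj₂ (inj₂ (e , ¬f))

  nearTwins⇒twins : ∀ {k u v} → NearTwins G k u v → Twins k u v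
  nearTwins⇒twins l = cov-⊆
    (λ { (inj₁ (e , ¬e)) → x∈p∪q⁺ (inj₁ (∈-─⁺ (∈-neighbors⁺ e) (¬e ∘ ∈-neighbors⁻)))
       ; (inj₂ (e , ¬e)) → x∈p∪q⁺ (inj₂ (∈-─⁺ (∈-neighbors⁺ e) (¬e ∘ ∈-neighbors⁻))) })
    (∣∣⇒cov _ l)

  twins⇒nearTwins : ∀ {k u v} → Twins k u v → NearTwins G k u v
  twins⇒nearTwins {u = u} {v} c = cov⇒∣∣ _ (cov-⊆ (λ x∈ → split (x∈p∪q⁻ _ _ x∈)) c)
    where
    nbrs : Vertex → Subset order
    nbrs = neighbors G
    split : ∀ {x} → x ∈ˢ nbrs u ─ nbrs v ⊎ x ∈ˢ nbrs v ─ nbrs u → Diff u v x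
    split (inj₁ x∈) with ∈-─⁻ (nbrs u) (nbrs v) x∈
    ... | e , ¬e = inj₁ (∈-neighbors⁻ e , ¬e ∘ ∈-neighbors⁺)
    split (inj₂ x∈) with ∈-─⁻ (nbrs v) (nbrs u) x∈
    ... | e , ¬e = inj₂ (∈-neighbors⁻ e , ¬e ∘ ∈-neighbors⁺)

  -- Without a common neighbour, all of the more than k neighbours of u would lie in the symmetric
  -- difference.
  common-neighbor : ∀ {k u v} → ¬ Cov (Adj u) k → Twins k u v → ∃[ w ] (Adj u w × Adj v w)
  common-neighbor {u = u} {v} ¬c c with Fin.any? (λ w → adj? u w ×-dec adj? v w)
  ... | yes e = e
  ... | no ¬e = ⊥-elim (¬c (cov-⊆ (λ {w} a → inj₁ (a , λ b → ¬e (w , a , b))) c))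

  ∈-ball⁺ : ∀ {r v u} → Dist≤ G r v u → u ∈ˢ ball G r v
  ∈-ball⁺ {r} {v} = ∈-subset⁺ (dist≤? G r v)

  ∈-ball⁻ : ∀ {r v u} → u ∈ˢ ball G r v → Dist≤ G r v u
  ∈-ball⁻ {r} {v} = ∈-subset⁻ (dist≤? G r v)

module _ (G : Graph) where
  open Graph G

  -- Neighbourhoods of vertices at distance at most r from v lie inside the
  -- ball of radius r + 1, so there near-twins of G and of the ball coincide.
  near-covered-ball : ∀ {r v k m} → NearCovered (induced G (ball G (suc r) v)) k m →
    {P : Vertex → Set} → Decidable P →
    (∀ {a b} → P a → P b → a ≢ b → ¬ Twins G k a b) →
    (∀ {a} → P a → Dist≤ G r v a) → Cov P m
  near-covered-ball {r} {v} {k} {m} nc {P} P? indep close =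
    cov-⊆ (λ {a} p → let i , eq = at-surjective (dist-mono G (n≤1+n r) (close p))
                      in i , ∈-subset⁺ P∘at? (subst P (sym eq) p) , sym eq)
      (cov-map at (∣∣⇒cov (subset P∘at?) (nc (subset P∘at?) indep′)))
    where
    B? : Decidable (_∈ˢ ball G (suc r) v)
    B? = _∈ˢ? ball G (suc r) v

    at : Fin (length (filter B? (allFin order))) → Vertex
    at = vertexAt B?

    P∘at? : Decidable (P ∘ at)
    P∘at? i = P? (at i)

    at-surjective : ∀ {a} → Dist≤ G (suc r) v a → ∃[ i ] at i ≡ a
    at-surjective d = vertexAt-surjective B? (∈-ball⁺ G d)

    module B = Graph (induced G (ball G (suc r) v))

    twins-lift : ∀ i j → P (at i) → P (at j) →
                 Twins (induced G (ball G (suc r) v)) k i j → Twins G k (at i) (at j)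
    twins-lift i j pi pj c = cov-⊆ lift (cov-map at c)
      where
      reach : ∀ {a w} → P a → Adj a w → ∃[ l ] at l ≡ w
      reach {a} {w} p e = at-surjective
        (subst (λ n → Dist≤ G n v w) (+-comm r 1) (dist-trans G (close p) (dist-adj G e)))
      adj⁺ : ∀ i j → Adj (at i) (at j) → B.Adj i j
      adj⁺ = graphOn-Adj⁺ B? (adj? G) Adj-sym Adj-irrefl
      adj⁻ : ∀ i j → B.Adj i j → Adj (at i) (at j)
      adj⁻ = graphOn-Adj⁻ B? (adj? G) Adj-sym Adj-irrefl
      lift : ∀ {w} → Diff G (at i) (at j) w →
        ∃[ l ] (((B.Adj i l × ¬ B.Adj j l) ⊎ (B.Adj j l × ¬ B.Adj i l)) × w ≡ at l)
      lift (inj₁ (e , ¬e)) with reach pi e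
      ... | l , refl = l , inj₁ (adj⁺ i l e , ¬e ∘ adj⁻ j l) , refl
      lift (inj₂ (e , ¬e)) with reach pj e
      ... | l , refl = l , inj₂ (adj⁺ j l e , ¬e ∘ adj⁻ i l) , refl

    indep′ : ∀ i j → i ∈ˢ subset P∘at? → j ∈ˢ subset P∘at? → i ≢ j →
             ¬ NearTwins (induced G (ball G (suc r) v)) k i j
    indep′ i j i∈ j∈ i≢j t =
      indep pi pj (i≢j ∘ vertexAt-injective B?)
        (twins-lift i j pi pj (nearTwins⇒twins (induced G (ball G (suc r) v)) t))
      where
      pi : P (at i)
      pi = ∈-subset⁻ P∘at? i∈
      pj : P (at j)
      pj = ∈-subset⁻ P∘at? j∈

-- Serves both directions: for the embedding given by an interpretation of range b, and for the
-- projection of hubs to representatives.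
dist-map : (G H : Graph) (f : Graph.Vertex G → Graph.Vertex H) (c : ℕ) →
           (∀ {u v} → Graph.Adj G u v → Dist≤ H c (f u) (f v)) →
           ∀ {r u v} → Dist≤ G r u v → Dist≤ H (r * c) (f u) (f v)
dist-map G H f c step (l , l≤r , p) = dist-mono H (*-monoˡ-≤ c l≤r) (along p)
  where
  along : ∀ {l u v} → Walk G l u v → Dist≤ H (l * c) (f u) (f v)
  along {zero}  refl        = dist-refl H
  along {suc l} (_ , e , p) = dist-trans H (step e) (along p)

-- Locality of first-order formulas

-- The difference between the levels `lo` and `hi` that suffices for `transfer`. A quantifier
-- doubles it, because its answer uses up one half; at a binary connective the sum dominates both
-- parts.
gap : ∀ {p n} → Formula p n → ℕ
gap ⊥ᶠ            = 1
gap (_ ≐ _)       = 1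
gap (edge _ _)    = 1
gap (colored _ _) = 1
gap (¬ᶠ φ)        = gap φ
gap (φ ∧ᶠ χ)      = gap φ + gap χ
gap (φ ∨ᶠ χ)      = gap φ + gap χ
gap (∃ᶠ φ)        = gap φ + gap φ
gap (∀ᶠ φ)        = gap φ + gap φ

0<gap : ∀ {p n} (φ : Formula p n) → 0 < gap φ
0<gap ⊥ᶠ            = s≤s z≤n
0<gap (_ ≐ _)       = s≤s z≤n
0<gap (edge _ _)    = s≤s z≤n
0<gap (colored _ _) = s≤s z≤n
0<gap (¬ᶠ φ)        = 0<gap φ
0<gap (φ ∧ᶠ χ)      = ≤-trans (0<gap φ) (m≤m+n _ _)
0<gap (φ ∨ᶠ χ)      = ≤-trans (0<gap φ) (m≤m+n _ _)
0<gap (∃ᶠ φ)        = ≤-trans (0<gap φ) (m≤m+n _ _)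
0<gap (∀ᶠ φ)        = ≤-trans (0<gap φ) (m≤m+n _ _)

-- L n x says that x has level at most n.  Levels grow by at most one along
-- edges, except along edges to vertices that do not tell x from its partner.
record LocalSymmetry {p} (H : ColoredGraph p) (N : ℕ) : Set₁ where
  open ColoredGraph H
  field
    L       : ℕ → Vertex → Set
    L?      : ∀ n → Decidable (L n)
    L-mono  : ∀ {m n x} → m ≤ n → L m x → L n x
    _~_     : Vertex → Vertex → Set
    ~-sym   : ∀ {x y} → x ~ y → y ~ x
    ~-total : ∀ {x} → L N x → ∃[ y ] x ~ y
    ~-level : ∀ {n x y} → n ≤ N → x ~ y → L n x → L n y
    ~-≡     : ∀ {x y x′ y′} → x ~ y → x′ ~ y′ → x ≡ x′ → y ≡ y′
    ~-adj   : ∀ {x y x′ y′} → x ~ y → x′ ~ y′ → Adj x x′ → Adj y y′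
    ~-color : ∀ {x y c} → x ~ y → x ∈ˢ color c → y ∈ˢ color c
    ~-far   : ∀ {n x y z} → n < N → x ~ y → L n x → ¬ L (suc n) z → Adj x z → Adj y z

-- Ehrenfeucht–Fraïssé: a new vertex is moved along ~ if its level is at most
-- lo + gap, and kept fixed otherwise; each quantifier halves the gap between
-- the levels lo of moved and hi of fixed vertices.
module _ {p} {H : ColoredGraph p} {N : ℕ} (sym~ : LocalSymmetry H N) where
  open ColoredGraph H
  open LocalSymmetry sym~

  data Match (lo hi : ℕ) (x y : Vertex) : Set where
    moved : x ~ y → L lo x → Match lo hi x y
    fixed : x ≡ y → ¬ L hi x → Match lo hi x y

  match-sym : ∀ {lo hi x y} → lo ≤ N → Match lo hi x y → Match lo hi y x
  match-sym lo≤N (moved x~y l)   = moved (~-sym x~y) (~-level lo≤N x~y l)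
  match-sym _    (fixed refl ¬l) = fixed refl ¬l

  match-widen : ∀ {lo lo′ hi hi′ x y} → lo ≤ lo′ → hi′ ≤ hi → Match lo hi x y → Match lo′ hi′ x y
  match-widen lo≤ hi≤ (moved x~y l)  = moved x~y (L-mono lo≤ l)
  match-widen lo≤ hi≤ (fixed eq ¬l) = fixed eq (¬l ∘ L-mono hi≤)

  match-≡ : ∀ {lo hi x y x′ y′} → lo < hi → Match lo hi x y → Match lo hi x′ y′ → x ≡ x′ → y ≡ y′
  match-≡ lt (moved x~y _) (moved x′~y′ _) eq = ~-≡ x~y x′~y′ eq
  match-≡ lt (fixed refl _) (fixed refl _) eq = eq
  match-≡ lt (moved _ l) (fixed refl ¬l) refl = ⊥-elim (¬l (L-mono (<⇒≤ lt) l))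
  match-≡ lt (fixed refl ¬l) (moved _ l) refl = ⊥-elim (¬l (L-mono (<⇒≤ lt) l))

  -- In the mixed cases the moved vertex has level at most `lo`, while the fixed one does not even
  -- have level at most `lo + 1`, so `~-far` applies.
  match-adj : ∀ {lo hi x y x′ y′} → lo < hi → hi ≤ N →
              Match lo hi x y → Match lo hi x′ y′ → Adj x x′ → Adj y y′
  match-adj lt h (moved x~y _) (moved x′~y′ _) e = ~-adj x~y x′~y′ e
  match-adj lt h (fixed refl _) (fixed refl _) e = e
  match-adj lt h (moved x~y l) (fixed refl ¬l) e =
    ~-far (≤-trans lt h) x~y l (¬l ∘ L-mono lt) e
  match-adj lt h (fixed refl ¬l) (moved x~y l) e =
    Adj-sym (~-far (≤-trans lt h) x~y l (¬l ∘ L-mono lt) (Adj-sym e))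

  Matches : ∀ {n} → ℕ → ℕ → Vec Vertex n → Vec Vertex n → Set
  Matches lo hi ρ ρ′ = ∀ i → Match lo hi (Vec.lookup ρ i) (Vec.lookup ρ′ i)

  extend : ∀ {n lo mid hi x y} {ρ ρ′ : Vec Vertex n} → lo ≤ mid → mid ≤ hi →
           Match mid hi x y ⊎ Match lo mid x y → Matches lo hi ρ ρ′ →
           Matches mid hi (x ∷ ρ) (y ∷ ρ′) ⊎ Matches lo mid (x ∷ ρ) (y ∷ ρ′)
  extend lo≤ ≤hi (inj₁ μ) ms = inj₁ λ { zero → μ ; (suc i) → match-widen lo≤ ≤-refl (ms i) }
  extend lo≤ ≤hi (inj₂ μ) ms = inj₂ λ { zero → μ ; (suc i) → match-widen ≤-refl ≤hi (ms i) }

  -- Either the new vertex moves and `lo` rises to `mid`, or it stays and `hi` drops to `mid`.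
  answer : ∀ {lo mid hi} → mid ≤ N → ∀ x → ∃[ y ] (Match mid hi x y ⊎ Match lo mid x y)
  answer {mid = mid} mid≤N x with L? mid x
  ... | yes l = let y , x~y = ~-total (L-mono mid≤N l) in y , inj₁ (moved x~y l)
  ... | no ¬l = x , inj₂ (fixed refl ¬l)

  transfer : ∀ {n lo hi} (φ : Formula p n) {ρ ρ′ : Vec Vertex n} →
             lo + gap φ ≤ hi → hi ≤ N → Matches lo hi ρ ρ′ → _⊨_ H ρ φ → _⊨_ H ρ′ φ

  private
    transfer-body : ∀ {n lo hi} (φ : Formula p (suc n)) {ρ ρ′ : Vec Vertex n} {x y} →
      lo + (gap φ + gap φ) ≤ hi → hi ≤ N → Matches lo hi ρ ρ′ →
      Match (lo + gap φ) hi x y ⊎ Match lo (lo + gap φ) x y → _⊨_ H (x ∷ ρ) φ → _⊨_ H (y ∷ ρ′) φ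

    lo<hi : ∀ {lo hi g} → 0 < g → lo + g ≤ hi → lo < hi
    lo<hi {lo} 0<g le = ≤-trans (≤-reflexive (+-comm 1 lo)) (≤-trans (+-monoʳ-≤ lo 0<g) le)

    mid≤hi : ∀ {lo hi} g → lo + (g + g) ≤ hi → lo + g ≤ hi
    mid≤hi {lo} g le = ≤-trans (+-monoʳ-≤ lo (m≤m+n g g)) le

  transfer (i ≐ j) le h ms = match-≡ (lo<hi (s≤s z≤n) le) (ms i) (ms j)
  transfer (edge i j) le h ms = match-adj (lo<hi (s≤s z≤n) le) h (ms i) (ms j)
  transfer (colored c i) {ρ} {ρ′} le h ms sat with Vec.lookup ρ i | Vec.lookup ρ′ i | ms i
  ... | _ | _ | moved x~y _  = ~-color x~y sat
  ... | _ | _ | fixed refl _ = sat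
  -- Satisfaction at `ρ′` is carried back along the reversed matches.
  transfer (¬ᶠ φ) le h ms ¬sat sat = ¬sat
    (transfer φ le h (λ i → match-sym (≤-trans (<⇒≤ (lo<hi (0<gap φ) le)) h) (ms i)) sat)
  transfer {lo = lo} (φ ∧ᶠ χ) le h ms (a , b) =
    transfer φ (≤-trans (+-monoʳ-≤ lo (m≤m+n _ _)) le) h ms a ,
    transfer χ (≤-trans (+-monoʳ-≤ lo (m≤n+m _ _)) le) h ms b
  transfer {lo = lo} (φ ∨ᶠ χ) le h ms (inj₁ a) =
    inj₁ (transfer φ (≤-trans (+-monoʳ-≤ lo (m≤m+n _ _)) le) h ms a)
  transfer {lo = lo} (φ ∨ᶠ χ) le h ms (inj₂ b) =
    inj₂ (transfer χ (≤-trans (+-monoʳ-≤ lo (m≤n+m _ (gap φ))) le) h ms b)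
  transfer (∃ᶠ φ) le h ms (x , sat) =
    let y , μ = answer (≤-trans (mid≤hi (gap φ) le) h) x in y , transfer-body φ le h ms μ sat
  -- The challenge `y` is on the side of `ρ′`: it is answered there by `x` and the match is then
  -- reversed.
  transfer {lo = lo} (∀ᶠ φ) le h ms sat y =
    let x , μ = answer {lo = lo} mid≤N y
    in transfer-body φ le h ms (Sum.map (match-sym mid≤N) (match-sym lo≤N) μ) (sat x)
    where
    mid≤N : lo + gap φ ≤ N
    mid≤N = ≤-trans (mid≤hi (gap φ) le) h
    lo≤N : lo ≤ N
    lo≤N = ≤-trans (m≤m+n lo (gap φ)) mid≤N

  transfer-body {lo = lo} {hi} φ le h ms μ with extend (m≤m+n lo (gap φ)) (mid≤hi (gap φ) le) μ ms
  ... | inj₁ ms′ = transfer φ (subst (_≤ hi) (sym (+-assoc lo (gap φ) (gap φ))) le) h ms′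
  ... | inj₂ ms′ = transfer φ ≤-refl (≤-trans (mid≤hi (gap φ) le) h) ms′

-- Balls that avoid the exceptional vertices.

ballSize : ℕ → ℕ → ℕ
ballSize d zero    = 1
ballSize d (suc n) = ballSize d n + ballSize d n * d

module _ (G : Graph) {S : Graph.Vertex G → Set} (S? : Decidable S) where
  open Graph G

  -- Walks of length at most n that avoid `S` after their start. The start is unrestricted, so
  -- reversing a walk requires it to be outside `S`.
  Reach : ℕ → Vertex → Vertex → Set
  Reach zero    u x = u ≡ x
  Reach (suc n) u x = Reach n u x ⊎ ∃[ y ] (Reach n u y × Adj y x × ¬ S x)

  reach? : ∀ n u → Decidable (Reach n u)
  reach? zero    u x = u Fin.≟ x
  reach? (suc n) u x =
    reach? n u x ⊎-dec Fin.any? (λ y → reach? n u y ×-dec adj? G y x ×-dec ¬? (S? x))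

  reach-mono : ∀ {m n u x} → m ≤ n → Reach m u x → Reach n u x
  reach-mono {n = zero}  z≤n r = r
  reach-mono {n = suc n} z≤n r = inj₁ (reach-mono {n = n} z≤n r)
  reach-mono (s≤s le) (inj₁ r)           = inj₁ (reach-mono le r)
  reach-mono (s≤s le) (inj₂ (y , r , e)) = inj₂ (y , reach-mono le r , e)

  reach-avoids : ∀ {n u x} → ¬ S u → Reach n u x → ¬ S x
  reach-avoids {zero}  ¬s refl                    = ¬s
  reach-avoids {suc n} ¬s (inj₁ r)                = reach-avoids {n} ¬s r
  reach-avoids {suc n} ¬s (inj₂ (_ , _ , _ , ¬s′)) = ¬s′

  reach-trans : ∀ {m n u x y} → Reach m u x → Reach n x y → Reach (n + m) u y
  reach-trans {n = zero}  r refl                 = r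
  reach-trans {n = suc n} r (inj₁ r′)            = inj₁ (reach-trans {n = n} r r′)
  reach-trans {n = suc n} r (inj₂ (z , r′ , e)) = inj₂ (z , reach-trans {n = n} r r′ , e)

  reach-sym : ∀ {n u x} → ¬ S u → Reach n u x → Reach n x u
  reach-sym {zero}  ¬s refl = refl
  reach-sym {suc n} ¬s (inj₁ r) = inj₁ (reach-sym {n} ¬s r)
  reach-sym {suc n} {u} {x} ¬s (inj₂ (y , r , e , _)) =
    subst (λ l → Reach l x u) (+-comm n 1) (reach-trans {1} {n}
      (inj₂ (x , refl , Adj-sym e , reach-avoids {n} ¬s r)) (reach-sym {n} ¬s r))

  reach-dist : ∀ {n u x} → Reach n u x → Dist≤ G n u x
  reach-dist {zero}  refl = dist-refl G
  reach-dist {suc n} (inj₁ r) = dist-mono G (n≤1+n n) (reach-dist {n} r)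
  reach-dist {suc n} {u} {x} (inj₂ (y , r , e , _)) =
    subst (λ l → Dist≤ G l u x) (+-comm n 1) (dist-trans G (reach-dist {n} r) (dist-adj G e))

  reach-cov : ∀ {n u d} → (∀ {y} → Reach n u y → Cov (Adj y) d) → Cov (Reach n u) (ballSize d n)
  reach-cov {zero}  {u} _ = cov [ u ] ≤-refl (here ∘ sym)
  reach-cov {suc n} {u} bd =
    cov-∪ (Sum.map₂ λ { (y , r , e , _) → y , r , e }) smaller
      (cov-bind (reach? n u) smaller (λ y r → bd (inj₁ r)))
    where smaller = reach-cov {n} {u} (λ r → bd (inj₁ r))

nth : ∀ {A : Set} → A → List A → ℕ → A
nth z []       _       = z
nth z (x ∷ _)  zero    = x
nth z (_ ∷ xs) (suc i) = nth z xs i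

nth-∈ : ∀ {A : Set} (z : A) {x xs} → x ∈ xs → ∃[ i ] (i < length xs × nth z xs i ≡ x)
nth-∈ z (here refl) = 0 , s≤s z≤n , refl
nth-∈ z (there x∈) = let i , lt , eq = nth-∈ z x∈ in suc i , s≤s lt , eq

-- Padded with z, or truncated if more than K elements satisfy P.
enumerate : ∀ {n} K {P : Fin n → Set} → Fin n → Decidable P → Fin K → Fin n
enumerate {n} K z P? i = nth z (filter P? (allFin n)) (toℕ i)

enumerate-surjective : ∀ {n K} {P : Fin n → Set} (z : Fin n) (P? : Decidable P) → Cov P K →
                       ∀ {x} → P x → ∃[ i ] enumerate K z P? i ≡ x
enumerate-surjective {n} z P? c px =
  let i , lt , eq = nth-∈ z (∈-filter⁺ P? (∈-allFin _) px)
      lt′ = ≤-trans lt (filter-length P? c)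
  in fromℕ< lt′ , trans (cong (nth z (filter P? (allFin n))) (Fin.toℕ-fromℕ< lt′)) eq

-- Finite descriptions of balls.

bitVectors : ∀ n → List (Vec Bool n)
bitVectors zero    = [ [] ]
bitVectors (suc n) = map (true ∷_) (bitVectors n) ++ map (false ∷_) (bitVectors n)

∈-bitVectors : ∀ {n} (bs : Vec Bool n) → bs ∈ bitVectors n
∈-bitVectors []           = here refl
∈-bitVectors (true  ∷ bs) = ∈-++⁺ˡ (∈-map⁺ (true ∷_) (∈-bitVectors bs))
∈-bitVectors (false ∷ bs) = ∈-++⁺ʳ (map (true ∷_) (bitVectors _)) (∈-map⁺ (false ∷_) (∈-bitVectors bs))

-- Fin K numbers the ball of a vertex, Fin F the exceptional vertices, and
-- level i n says that the i-th vertex of the ball has level at most n.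
data Fact (p K F N : ℕ) : Set where
  same link : Fin K → Fin K → Fact p K F N
  hue       : Fin K → Fin p → Fact p K F N
  tie       : Fin K → Fin F → Fact p K F N
  level     : Fin K → Fin (suc N) → Fact p K F N

facts : ∀ p K F N → List (Fact p K F N)
facts p K F N =
  cartesianProductWith same (allFin K) (allFin K) ++
  cartesianProductWith link (allFin K) (allFin K) ++
  cartesianProductWith hue (allFin K) (allFin p) ++
  cartesianProductWith tie (allFin K) (allFin F) ++
  cartesianProductWith level (allFin K) (allFin (suc N))

∈-facts : ∀ {p K F N} (a : Fact p K F N) → a ∈ facts p K F N
∈-facts {p} {K} {F} {N} = λ where
    (same i j)  → ∈-++⁺ˡ (pair same i j)
    (link i j)  → ∈-++⁺ʳ (all same) (∈-++⁺ˡ (pair link i j))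
    (hue i c)   → ∈-++⁺ʳ (all same) (∈-++⁺ʳ (all link) (∈-++⁺ˡ (pair hue i c)))
    (tie i j)   → ∈-++⁺ʳ (all same) (∈-++⁺ʳ (all link) (∈-++⁺ʳ (all hue) (∈-++⁺ˡ (pair tie i j))))
    (level i n) → ∈-++⁺ʳ (all same) (∈-++⁺ʳ (all link) (∈-++⁺ʳ (all hue) (∈-++⁺ʳ (all tie) (pair level i n))))
  where
  all : ∀ {m n} → (Fin m → Fin n → Fact p K F N) → List (Fact p K F N)
  all {m} {n} f = cartesianProductWith f (allFin m) (allFin n)
  pair : ∀ {m n} (f : Fin m → Fin n → Fact p K F N) i j → f i j ∈ all f
  pair f i j = ∈-cartesianProductWith⁺ f (∈-allFin i) (∈-allFin j)

-- Exchanging balls with equal descriptions.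

module _ {p} (H : ColoredGraph p) (ψ : Formula p 2) where
  open ColoredGraph H

  SatDiff : Vertex → Vertex → Vertex → Set
  SatDiff u v w = (Sat₂ H ψ u w × ¬ Sat₂ H ψ v w) ⊎ (Sat₂ H ψ v w × ¬ Sat₂ H ψ u w)

  satDiff? : ∀ u v → Decidable (SatDiff u v)
  satDiff? u v w = (sat₂? H ψ u w ×-dec ¬? (sat₂? H ψ v w)) ⊎-dec (sat₂? H ψ v w ×-dec ¬? (sat₂? H ψ u w))

module _ {p} (H : ColoredGraph p) (N d F : ℕ) (z : ColoredGraph.Vertex H)
         {S : ColoredGraph.Vertex H → Set} (S? : Decidable S) (covS : Cov S F) where
  open ColoredGraph H

  private
    R : ℕ → Vertex → Vertex → Set
    R = Reach graph S?

    -- Twice N + 1: two vertices outside `S` that do not reach each other within `radius` have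
    -- disjoint balls of radius N + 1.
    radius : ℕ
    radius = suc N + suc N

    K : ℕ
    K = ballSize d radius

    e : Vertex → Fin K → Vertex
    e u = enumerate K u (reach? graph S? radius u)

    exceptional : Fin F → Vertex
    exceptional = enumerate F z S?

  Holds : Vertex → Fact p K F N → Set
  Holds u (same i j)  = e u i ≡ e u j
  Holds u (link i j)  = Adj (e u i) (e u j)
  Holds u (hue i c)   = e u i ∈ˢ color c
  Holds u (tie i j)   = Adj (e u i) (exceptional j)
  Holds u (level i n) = R (toℕ n) u (e u i)

  holds? : ∀ u → Decidable (Holds u)
  holds? u (same i j)  = e u i Fin.≟ e u j
  holds? u (link i j)  = adj? graph (e u i) (e u j)
  holds? u (hue i c)   = e u i ∈ˢ? color c
  holds? u (tie i j)   = adj? graph (e u i) (exceptional j)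
  holds? u (level i n) = reach? graph S? (toℕ n) u (e u i)

  codeLength : ℕ
  codeLength = length (facts p K F N)

  abstract
    -- If two codes are equal, pairing the i-th vertices of the two balls preserves equality,
    -- adjacency, colors, levels and the adjacencies to `S`.
    code : Vertex → Vec Bool codeLength
    code u = Vec.tabulate (λ i → does (holds? u (lookup (facts p K F N) i)))

    code-holds : ∀ {u u′} → code u ≡ code u′ → ∀ a → Holds u a → Holds u′ a
    code-holds {u} {u′} eq a h with holds? u′ a
    ... | yes h′ = h′
    ... | no ¬h′ = ⊥-elim (¬h′ (subst (Holds u′) (sym at-i)
                     (witness (holds? u′ (lookup xs i)) (trans (sym bits) (dec-true (holds? u (lookup xs i)) (subst (Holds u) at-i h))))))
      where
      xs : List (Fact p K F N)
      xs = facts p K F N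
      i : Fin (length xs)
      i = Any.index (∈-facts a)
      at-i : a ≡ lookup xs i
      at-i = lookup-index (∈-facts a)
      bits : does (holds? u (lookup xs i)) ≡ does (holds? u′ (lookup xs i))
      bits = trans (sym (lookup∘tabulate _ i)) (trans (cong (λ v → Vec.lookup v i) eq) (lookup∘tabulate _ i))
      witness : ∀ {A : Set} (a? : Dec A) → does a? ≡ true → A
      witness (yes a) _ = a

  -- Degrees at most `d` bound the ball by `K`, so that `e u` lists all of it without truncation.
  Tame : Vertex → Set
  Tame u = ¬ S u × (∀ {y} → R radius u y → Cov (Adj y) d)

  tame-cov : ∀ {u n} → n ≤ radius → Tame u → Cov (R n u) K
  tame-cov n≤ (_ , bd) = cov-⊆ (reach-mono graph S? n≤) (reach-cov graph S? {radius} bd)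

  N≤radius : N ≤ radius
  N≤radius = ≤-trans (n≤1+n N) (m≤m+n (suc N) (suc N))

  module _ {u u′} (tu : Tame u) (tu′ : Tame u′)
           (to : ∀ a → Holds u a → Holds u′ a)
           (disjoint : ∀ {x} → R (suc N) u x → ¬ R (suc N) u′ x) where

    -- One half of the exchange. Everything here rests on the single implication `to`, so the other
    -- half arises by interchanging u and u′.
    Side : Vertex → Vertex → Set
    Side x y = ∃[ i ] (x ≡ e u i × y ≡ e u′ i × R N u x × R N u′ y)

    side-level⁺ : ∀ {n i} → n ≤ N → R n u (e u i) → R n u′ (e u′ i)
    side-level⁺ {n} {i} n≤N r = subst (λ l → R l u′ (e u′ i)) eq
      (to (level i (fromℕ< (s≤s n≤N))) (subst (λ l → R l u (e u i)) (sym eq) r))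
      where
      eq : toℕ (fromℕ< (s≤s n≤N)) ≡ n
      eq = Fin.toℕ-fromℕ< (s≤s n≤N)

    side-image : ∀ {n x} → n ≤ N → R n u x → ∃[ y ] (Side x y × R n u′ y)
    side-image {n} {x} n≤N r with enumerate-surjective u (reach? graph S? radius u)
        (tame-cov ≤-refl tu) (reach-mono graph S? (≤-trans n≤N N≤radius) r)
    ... | i , refl = e u′ i
                   , (i , refl , refl , reach-mono graph S? n≤N r , reach-mono graph S? n≤N (side-level⁺ n≤N r))
                   , side-level⁺ n≤N r

    side-level : ∀ {n x y} → n ≤ N → Side x y → R n u x → R n u′ y
    side-level n≤N (i , refl , refl , _) = side-level⁺ n≤N

    side-≡ : ∀ {x y x′ y′} → Side x y → Side x′ y′ → x ≡ x′ → y ≡ y′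
    side-≡ (i , refl , refl , _) (j , refl , refl , _) = to (same i j)

    side-adj : ∀ {x y x′ y′} → Side x y → Side x′ y′ → Adj x x′ → Adj y y′
    side-adj (i , refl , refl , _) (j , refl , refl , _) = to (link i j)

    side-color : ∀ {x y c} → Side x y → x ∈ˢ color c → y ∈ˢ color c
    side-color {c = c} (i , refl , refl , _) = to (hue i c)

    side-tie : ∀ {x y s} → S s → Side x y → Adj x s → Adj y s
    side-tie s∈ (i , refl , refl , _) with enumerate-surjective z S? covS s∈
    ... | j , refl = to (tie i j)

    -- An edge between the two N-balls would put its end into both balls of radius N + 1; hence
    -- disjointness is assumed one step further out.
    apart : ∀ {x x′} → R N u x → R N u′ x′ → ¬ (x ≡ x′ ⊎ Adj x x′)
    apart r r′ (inj₁ refl) = disjoint (inj₁ r) (inj₁ r′)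
    apart r r′ (inj₂ a) = disjoint (inj₂ (_ , r , a , reach-avoids graph S? {N} (proj₁ tu′) r′)) (inj₁ r′)

  module _ {u u′} (tu : Tame u) (tu′ : Tame u′) (eq : code u ≡ code u′)
           (disjoint : ∀ {x} → R (suc N) u x → ¬ R (suc N) u′ x) where

    private
      disjoint′ : ∀ {x} → R (suc N) u′ x → ¬ R (suc N) u x
      disjoint′ r′ r = disjoint r r′

      _⇄_ : Vertex → Vertex → Set
      x ⇄ y = Side tu tu′ (code-holds eq) disjoint x y ⊎ Side tu′ tu (code-holds (sym eq)) disjoint′ x y

    -- The two halves together form a symmetric relation, whose mixed cases are excluded by
    -- disjointness. Adjacency to the far vertices in `S` is preserved because it is part of the
    -- code.
    swapBalls : LocalSymmetry H N
    swapBalls = record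
      { L = λ n x → R n u x ⊎ R n u′ x
      ; L? = λ n x → reach? graph S? n u x ⊎-dec reach? graph S? n u′ x
      ; L-mono = λ m≤n → Sum.map (reach-mono graph S? m≤n) (reach-mono graph S? m≤n)
      ; _~_ = _⇄_
      ; ~-sym = λ
          { (inj₁ (i , p , q , r , r′)) → inj₂ (i , q , p , r′ , r)
          ; (inj₂ (i , p , q , r , r′)) → inj₁ (i , q , p , r′ , r) }
      ; ~-total = λ
          { (inj₁ r) → let y , s , _ = side-image tu tu′ to disjoint ≤-refl r in y , inj₁ s
          ; (inj₂ r) → let y , s , _ = side-image tu′ tu from disjoint′ ≤-refl r in y , inj₂ s }
      ; ~-level = λ
          { n≤N (inj₁ s) (inj₁ r) → inj₂ (side-level tu tu′ to disjoint n≤N s r)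
          ; n≤N (inj₂ s) (inj₂ r) → inj₁ (side-level tu′ tu from disjoint′ n≤N s r)
          ; n≤N (inj₁ (_ , _ , _ , r , _)) (inj₂ r′) → ⊥-elim (disjoint (inj₁ r) (inj₁ (reach-mono graph S? n≤N r′)))
          ; n≤N (inj₂ (_ , _ , _ , r , _)) (inj₁ r′) → ⊥-elim (disjoint (inj₁ (reach-mono graph S? n≤N r′)) (inj₁ r)) }
      ; ~-≡ = λ
          { (inj₁ s) (inj₁ s′) → side-≡ tu tu′ to disjoint s s′
          ; (inj₂ s) (inj₂ s′) → side-≡ tu′ tu from disjoint′ s s′
          ; (inj₁ (_ , _ , _ , r , _)) (inj₂ (_ , _ , _ , r′ , _)) x≡x′ → ⊥-elim (apart tu tu′ to disjoint r r′ (inj₁ x≡x′))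
          ; (inj₂ (_ , _ , _ , r , _)) (inj₁ (_ , _ , _ , r′ , _)) x≡x′ → ⊥-elim (apart tu′ tu from disjoint′ r r′ (inj₁ x≡x′)) }
      ; ~-adj = λ
          { (inj₁ s) (inj₁ s′) → side-adj tu tu′ to disjoint s s′
          ; (inj₂ s) (inj₂ s′) → side-adj tu′ tu from disjoint′ s s′
          ; (inj₁ (_ , _ , _ , r , _)) (inj₂ (_ , _ , _ , r′ , _)) a → ⊥-elim (apart tu tu′ to disjoint r r′ (inj₂ a))
          ; (inj₂ (_ , _ , _ , r , _)) (inj₁ (_ , _ , _ , r′ , _)) a → ⊥-elim (apart tu′ tu from disjoint′ r r′ (inj₂ a)) }
      ; ~-color = λ
          { (inj₁ s) → side-color tu tu′ to disjoint s
          ; (inj₂ s) → side-color tu′ tu from disjoint′ s }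
      ; ~-far = far
      }
      where
      to : ∀ a → Holds u a → Holds u′ a
      to = code-holds eq
      from : ∀ a → Holds u′ a → Holds u a
      from = code-holds (sym eq)
      far : ∀ {n x y w} → n < N → x ⇄ y → R n u x ⊎ R n u′ x →
            ¬ (R (suc n) u w ⊎ R (suc n) u′ w) → Adj x w → Adj y w
      far {w = w} n<N x⇄y l ¬l a with S? w
      far n<N (inj₁ s) l ¬l a | yes s∈ = side-tie tu tu′ to disjoint s∈ s a
      far n<N (inj₂ s) l ¬l a | yes s∈ = side-tie tu′ tu from disjoint′ s∈ s a
      -- Outside `S`, the edge would give its far end level at most n + 1.
      far n<N x⇄y l ¬l a | no s∉ =
        ⊥-elim (¬l (Sum.map (λ r → inj₂ (_ , r , a , s∉)) (λ r → inj₂ (_ , r , a , s∉)) l))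

    swap-sat : (ψ : Formula p 2) → gap ψ ≤ N → ∀ {w} → ¬ (R N u w ⊎ R N u′ w) →
               Sat₂ H ψ u w → Sat₂ H ψ u′ w
    swap-sat ψ g≤N ¬l = transfer swapBalls {lo = 0} {hi = N} ψ g≤N ≤-refl λ
      { zero → start ; (suc zero) → fixed refl ¬l }
      where
      start : Match swapBalls 0 N u u′
      start with side-image tu tu′ (code-holds eq) disjoint {0} z≤n refl
      -- The only vertex at level 0 around `u′` is `u′` itself, so it is the partner of `u`.
      ... | _ , s , refl = moved (inj₁ s) (inj₁ refl)

  -- By `swap-sat`, ψ distinguishes the two vertices only inside their N-balls, each of size at most
  -- `K`.
  same-code-twins : (ψ : Formula p 2) → gap ψ ≤ N → ∀ {u u′} → Tame u → Tame u′ → code u ≡ code u′ →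
    ¬ R radius u u′ → Cov (SatDiff H ψ u u′) (K + K)
  same-code-twins ψ g≤N {u} {u′} tu tu′ eq ¬r =
    cov-∪ split (tame-cov N≤radius tu) (tame-cov N≤radius tu′)
    where
    disjoint : ∀ {x} → R (suc N) u x → ¬ R (suc N) u′ x
    disjoint r r′ = ¬r (reach-trans graph S? {suc N} {suc N} r (reach-sym graph S? {suc N} (proj₁ tu′) r′))
    split : ∀ {w} → SatDiff H ψ u u′ w → R N u w ⊎ R N u′ w
    split {w} sd with reach? graph S? N u w ⊎-dec reach? graph S? N u′ w
    ... | yes l = l
    split (inj₁ (a , ¬a)) | no ¬l = ⊥-elim (¬a (swap-sat tu tu′ eq disjoint ψ g≤N ¬l a))
    split (inj₂ (a , ¬a)) | no ¬l = ⊥-elim (¬a (swap-sat tu′ tu (sym eq) (λ r r′ → disjoint r′ r) ψ g≤N (¬l ∘ Sum.swap) a))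

  -- Outside `S`, all members of `T` with a given code lie in the ball around any one of them, as
  -- two that are far apart would be near-twins. Each code thus accounts for at most `K` vertices.
  few-untwinned : (ψ : Formula p 2) → gap ψ ≤ N → {T : Vertex → Set} → Decidable T →
    (∀ {u} → T u → S u ⊎ Tame u) →
    (∀ {u u′} → T u → T u′ → u ≢ u′ → ¬ Cov (SatDiff H ψ u u′) (K + K)) →
    Cov T (F + length (bitVectors codeLength) * K)
  few-untwinned ψ g≤N {T} T? tame indep =
    cov-∪ split covS (cov-bind {P = λ _ → ⊤} (λ _ → yes tt) (cov (bitVectors codeLength) ≤-refl (λ {c} _ → ∈-bitVectors c))
      (λ c _ → fibre c))
    where
    Coded : Vec Bool codeLength → Vertex → Set
    Coded c u = (T u × ¬ S u) × code u ≡ c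

    coded? : ∀ c → Decidable (Coded c)
    coded? c u = (T? u ×-dec ¬? (S? u)) ×-dec ≡-dec Bool._≟_ (code u) c

    tame′ : ∀ {c u} → Coded c u → Tame u
    tame′ ((t , ¬s) , _) with tame t
    ... | inj₁ s  = ⊥-elim (¬s s)
    ... | inj₂ tu = tu

    split : ∀ {u} → T u → S u ⊎ ∃[ c ] (⊤ × Coded c u)
    split {u} t with S? u
    ... | yes s = inj₁ s
    ... | no ¬s = inj₂ (code u , tt , (t , ¬s) , refl)

    fibre : ∀ c → Cov (Coded c) K
    fibre c with Fin.any? (coded? c)
    ... | no ¬e = cov-∅ (λ cu → ¬e (_ , cu))
    ... | yes (t , ct) = cov-⊆ close (tame-cov ≤-refl (tame′ ct))
      where
      close : ∀ {u} → Coded c u → R radius t u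
      close {u} cu with reach? graph S? radius t u
      ... | yes r = r
      ... | no ¬r = ⊥-elim (indep (proj₁ (proj₁ ct)) (proj₁ (proj₁ cu))
              (λ { refl → ¬r (reach-mono graph S? z≤n refl) })
              (same-code-twins ψ g≤N (tame′ ct) (tame′ cu) (trans (proj₂ ct) (sym (proj₂ cu))) ¬r))

-- Near-covers from interpretations of bounded range.

module _ {p} (I : Interpretation p) {b : ℕ} (range : HasRange (Interpretation.ψ I) b) (f d : ℕ → ℕ) where
  open Interpretation I

  private
    N radius : ℕ
    N = gap ψ
    radius = suc N + suc N

    -- The image of a ball of radius r stays within r * b of the image of its centre, and the balls
    -- around its points extend `radius` further.
    R K : ℕ → ℕ
    R r = r * b + radius
    K r = ballSize (d (R r)) radius

  interpretation-twins interpretation-classes : ℕ → ℕ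
  interpretation-twins r = K r + K r
  interpretation-classes r =
    f (R r) + length (bitVectors (length (facts p (K r) (f (R r)) N))) * K r

  module _ (G : Graph) (H : ColoredGraph p)
           (bounded : ∀ r v → ∣ ball (ColoredGraph.graph H) r v ∩ degreeAbove (ColoredGraph.graph H) (d r) ∣ ≤ f r)
           (iso : G ≅ interpret I H) where

    private
      module G = Graph G
      module H = ColoredGraph H

      δ? : Decidable (Sat₁ H δ)
      δ? = sat₁? H δ

      η : G.Vertex → H.Vertex
      η x = vertexAt δ? (Inverse.to (proj₁ iso) x)

      η-injective : ∀ {x y} → η x ≡ η y → x ≡ y
      η-injective eq = Injection.injective (↔⇒↣ (proj₁ iso)) (vertexAt-injective δ? eq)

      η-adj⁺ : ∀ {x y} → G.Adj x y → Sat₂ H ψ (η x) (η y)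
      η-adj⁺ {x} {y} e = graphOn-Adj⁻ δ? (sat₂? H ψ) (ψ-sym H) (ψ-irrefl H) _ _
        (Equivalence.to (proj₂ iso x y) e)

      η-adj⁻ : ∀ {x y} → Sat₂ H ψ (η x) (η y) → G.Adj x y
      η-adj⁻ {x} {y} e = Equivalence.from (proj₂ iso x y)
        (graphOn-Adj⁺ δ? (sat₂? H ψ) (ψ-sym H) (ψ-irrefl H) _ _ e)

      η-near : ∀ {x y} → G.Adj x y → Dist≤ H.graph b (η x) (η y)
      η-near {x} {y} e = decidable-stable (dist≤? H.graph b (η x) (η y))
        (λ far → range H _ _ far (η-adj⁺ e))

    -- The exceptional vertices are those of large degree near the image of `v`. The bound of
    -- `few-untwinned` on the image of `T` is pulled back along the injection `ι`.
    interpretation-near-covered : ∀ r v →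
      NearCovered (induced G (ball G r v)) (interpretation-twins r) (interpretation-classes r)
    interpretation-near-covered r v T indep = cov⇒∣∣ T (cov-⊆ (λ {i} i∈ → i , i∈ , refl)
      (cov-preimage image? Fin._≟_ ι ι-injective
        (few-untwinned H N (d (R r)) (f (R r)) (η v) exceptional? few-exceptional ψ ≤-refl
          image? tame untwinned)))
      where
      B? : Decidable (_∈ˢ ball G r v)
      B? = _∈ˢ? ball G r v

      X : Graph
      X = induced G (ball G r v)

      module X = Graph X

      ι : X.Vertex → H.Vertex
      ι i = η (vertexAt B? i)

      ι-injective : ∀ {i j} → ι i ≡ ι j → i ≡ j
      ι-injective eq = vertexAt-injective B? (η-injective eq)

      Image : H.Vertex → Set
      Image h = ∃[ i ] (i ∈ˢ T × ι i ≡ h)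

      image? : Decidable Image
      image? h = Fin.any? (λ i → (i ∈ˢ? T) ×-dec (ι i Fin.≟ h))

      Exceptional : H.Vertex → Set
      Exceptional x = Dist≤ H.graph (R r) (η v) x × ¬ Cov (H.Adj x) (d (R r))

      exceptional? : Decidable Exceptional
      exceptional? x = dist≤? H.graph (R r) (η v) x ×-dec ¬? (cov? (adj? H.graph x) (d (R r)))

      few-exceptional : Cov Exceptional (f (R r))
      few-exceptional = cov-⊆ (λ { (near , ¬c) → x∈p∩q⁺ (∈-ball⁺ H.graph near , ∈-degreeAbove⁺ H.graph ¬c) })
        (∣∣⇒cov _ (bounded (R r) (η v)))

      tame : ∀ {u} → Image u → Exceptional u ⊎ Tame H N (d (R r)) (f (R r)) (η v) exceptional? few-exceptional u
      tame {u} (i , i∈ , refl) with exceptional? u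
      ... | yes s = inj₁ s
      -- Every reached `y` is near enough to be exceptional if its degree were large, but `Reach`
      -- avoids exceptional vertices.
      ... | no ¬s = inj₂ (¬s , λ {y} reach → decidable-stable (cov? (adj? H.graph y) (d (R r)))
              (λ ¬c → reach-avoids H.graph exceptional? {radius} ¬s reach
                (dist-trans H.graph near (reach-dist H.graph exceptional? {radius} reach) , ¬c)))
        where
        near : Dist≤ H.graph (r * b) (η v) (ι i)
        near = dist-map G H.graph η b η-near {r} (∈-ball⁻ G {r} (vertexAt-P B? i))

      untwinned : ∀ {u u′} → Image u → Image u′ → u ≢ u′ →
        ¬ Cov (SatDiff H ψ u u′) (K r + K r)
      untwinned (i , i∈ , refl) (j , j∈ , refl) i≢j c =
        indep i j i∈ j∈ (i≢j ∘ cong ι) (twins⇒nearTwins X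
          (cov-⊆ (Sum.map both both) (cov-preimage (satDiff? H ψ (ι i) (ι j)) Fin._≟_ ι ι-injective c)))
        where
        both : ∀ {i j w} → X.Adj i w × ¬ X.Adj j w → Sat₂ H ψ (ι i) (ι w) × ¬ Sat₂ H ψ (ι j) (ι w)
        both {i} {j} {w} (e , ¬e) =
          η-adj⁺ (graphOn-Adj⁻ B? (adj? G) G.Adj-sym G.Adj-irrefl i w e) ,
          λ s → ¬e (graphOn-Adj⁺ B? (adj? G) G.Adj-sym G.Adj-irrefl j w (η-adj⁻ s))

-- The hub graph of a locally almost near-covered graph

-- Two k₀-near-twins of the same vertex are twinBound k₀-near-twins.
twinBound : ℕ → ℕ
twinBound k₀ = k₀ + k₀

-- Large enough for every union bound on the size of a class to fail above it.
classBound : ℕ → ℕ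
classBound k₀ = suc q * (suc q * q) + (q + q + q)
  where
  q : ℕ
  q = twinBound k₀

-- The summands serve, in order, vertices of low degree, members of large classes, members of small
-- classes, and hubs.
degreeBound : ℕ → ℕ → ℕ → ℕ
degreeBound k₀ m₀ K = k₀ + ((1 + (twinBound k₀ + m₀ * classBound k₀)) + (K + (K * K + m₀)))

module HubGraph (G : Graph) (k₀ : ℕ) where
  open Graph G

  High : Vertex → Set
  High x = ¬ Cov (Adj x) k₀

  high? : Decidable High
  high? x = ¬? (cov? (adj? G x) k₀)

  module _ (R : MaximalIndependent (Twins G k₀) High) where
    open MaximalIndependent R renaming (chosen to reps)

    isRep? : Decidable (_∈ reps)
    isRep? a = Any.any? (a Fin.≟_) reps

    abstract
      -- On vertices of low degree the value is a placeholder, hence `High` in the definition of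
      -- `Class`.
      rep : Vertex → Vertex
      rep x with high? x
      ... | yes h = proj₁ (maximal h)
      ... | no  _ = x

      rep-∈ : ∀ {x} → High x → rep x ∈ reps
      rep-∈ {x} h with high? x
      ... | yes h′ = proj₁ (proj₂ (maximal h′))
      ... | no ¬h  = ⊥-elim (¬h h)

      rep-twin : ∀ {x} → High x → Twins G k₀ x (rep x)
      rep-twin {x} h with high? x
      ... | yes h′ = proj₂ (proj₂ (maximal h′))
      ... | no ¬h  = ⊥-elim (¬h h)

    -- Classes of near-twins and the pairs to complement.

    Class : Vertex → Vertex → Set
    Class a x = High x × rep x ≡ a

    class? : ∀ a → Decidable (Class a)
    class? a x = high? x ×-dec (rep x Fin.≟ a)

    class-∈ : ∀ {a x} → Class a x → a ∈ reps
    class-∈ (h , refl) = rep-∈ h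

    q s : ℕ
    q = twinBound k₀
    s = classBound k₀

    q≤3q : q ≤ q + q + q
    q≤3q = m≤n+m q (q + q)

    3q≤s : q + q + q ≤ s
    3q≤s = m≤n+m (q + q + q) (suc q * (suc q * q))

    q≤s : q ≤ s
    q≤s = ≤-trans q≤3q 3q≤s

    pq≤s : suc q * q ≤ s
    pq≤s = ≤-trans (m≤n*m (suc q * q) (suc q)) (m≤m+n _ _)

    class-twins : ∀ {a x y} → Class a x → Class a y → Twins G q x y
    class-twins (hx , refl) (hy , eq) =
      twins-trans G (rep-twin hx) (subst (λ a → Twins G k₀ a _) eq (twins-sym G (rep-twin hy)))

    Large : Vertex → Set
    Large a = ¬ Cov (Class a) s

    large? : Decidable Large
    large? a = ¬? (cov? (class? a) s)

    large-∈ : ∀ {a} → Large a → a ∈ reps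
    large-∈ {a} l = class-∈ (proj₂ (some (class? a) l))

    classAdj? : ∀ b x → Decidable (λ y → Class b y × Adj x y)
    classAdj? b x y = class? b y ×-dec adj? G x y

    classNonadj? : ∀ b x → Decidable (λ y → Class b y × ¬ Adj x y)
    classNonadj? b x y = class? b y ×-dec ¬? (adj? G x y)

    -- A q-near-twin of x misses at most q of these q + 1 neighbours.
    hit : ∀ {x x′ xs} → Unique xs → length xs ≡ suc q → All (Adj x) xs → Twins G q x x′ → Any (Adj x′) xs
    hit {x} {x′} {xs} xs! len all t with Any.any? (adj? G x′) xs
    ... | yes e = e
    ... | no ¬e = ⊥-elim (1+n≰n (subst (_≤ q) len (cov-unique xs!
                    (All.zipWith inj₁ (all , All.¬Any⇒All¬ xs ¬e)) t)))

    miss : ∀ {x x′ xs} → Unique xs → length xs ≡ suc q → All (¬_ ∘ Adj x) xs → Twins G q x x′ →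
           Any (¬_ ∘ Adj x′) xs
    miss {x} {x′} {xs} xs! len all t with Any.any? (¬? ∘ adj? G x′) xs
    ... | yes e = e
    ... | no ¬e = ⊥-elim (1+n≰n (subst (_≤ q) len (cov-unique xs!
                    (All.zipWith (λ { (¬f , f) → inj₂ (f , ¬f) })
                      (all , All.map (λ {y} ¬¬f → stable y ¬¬f) (All.¬Any⇒All¬ xs ¬e))) t)))
      where
      stable : ∀ y → ¬ ¬ Adj x′ y → Adj x′ y
      stable y ¬¬f with adj? G x′ y
      ... | yes f = f
      ... | no ¬f = ⊥-elim (¬¬f ¬f)

    -- With q + 1 neighbours and q + 1 non-neighbours of x in class b, every
    -- member of class a distinguishes some pair of them, but each pair of
    -- near-twins is distinguished by at most q vertices.
    dichotomy : ∀ {a b x} → Large a → Class a x → ¬ Cov (λ y → Class b y × Adj x y) q →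
                Cov (λ y → Class b y × ¬ Adj x y) q
    dichotomy {a} {b} {x} la cx ¬sparse with cov? (classNonadj? b x) q
    ... | yes dense = dense
    ... | no ¬dense with many (classAdj? b x) ¬sparse | many (classNonadj? b x) ¬dense
    ...   | ys , ys! , ys-all , ys-len | zs , zs! , zs-all , zs-len =
      ⊥-elim (la (cov-mono distinguished (m≤m+n _ _)
        (cov-bind (λ y → Any.any? (y Fin.≟_) ys) (cov-≤ (≤-reflexive ys-len) (cov-∈ ys)) λ y y∈ →
         cov-bind (λ z → Any.any? (z Fin.≟_) zs) (cov-≤ (≤-reflexive zs-len) (cov-∈ zs)) λ z z∈ →
         class-twins (proj₁ (All.lookup ys-all y∈)) (proj₁ (All.lookup zs-all z∈)))))
      where
      distinguished : ∀ {x′} → Class a x′ →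
        ∃[ y ] (y ∈ ys × ∃[ z ] (z ∈ zs × Diff G y z x′))
      distinguished cx′ with find (hit ys! ys-len (All.map proj₂ ys-all) (class-twins cx cx′))
                           | find (miss zs! zs-len (All.map proj₂ zs-all) (class-twins cx cx′))
      ... | y , y∈ , e | z , z∈ , ¬e = y , y∈ , z , z∈ , inj₁ (Adj-sym e , ¬e ∘ Adj-sym)

    -- The almost complete pairs, including a = b. One member with more than q neighbours suffices
    -- as a witness, since `flip-dense` spreads density to the whole class.
    Flip : Vertex → Vertex → Set
    Flip a b = Large a × Large b × ∃[ x ] (Class a x × ¬ Cov (λ y → Class b y × Adj x y) q)

    flip? : ∀ a b → Dec (Flip a b)
    flip? a b = large? a ×-dec large? b ×-dec
      Fin.any? (λ x → class? a x ×-dec ¬? (cov? (classAdj? b x) q))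

    -- The witness x₀ misses at most q members of class b, and x differs from x₀ on at most q
    -- vertices. If x also had at most q neighbours there, class b would have at most 3q members and
    -- not be large.
    flip-dense : ∀ {a b x} → Flip a b → Class a x → Cov (λ y → Class b y × ¬ Adj x y) q
    flip-dense {a} {b} {x} (la , lb , x₀ , cx₀ , ¬sparse₀) cx = dichotomy la cx ¬sparse
      where
      split : ∀ {y} → Class b y → ((Class b y × ¬ Adj x₀ y) ⊎ Diff G x₀ x y) ⊎ (Class b y × Adj x y)
      split {y} c with adj? G x₀ y | adj? G x y
      ... | _     | yes e = inj₂ (c , e)
      ... | no ¬f | no _  = inj₁ (inj₁ (c , ¬f))
      ... | yes f | no ¬e = inj₁ (inj₂ (inj₁ (f , ¬e)))
      ¬sparse : ¬ Cov (λ y → Class b y × Adj x y) q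
      ¬sparse sparse = lb (cov-≤ 3q≤s
        (cov-∪ split (cov-∪ id (dichotomy la cx₀ ¬sparse₀) (class-twins cx₀ cx)) sparse))

    -- Each of q + 1 members of class a misses at most q members of class b. As class b is larger
    -- than (q + 1)q, some member of it is adjacent to all of them and witnesses the reverse flip.
    flip-sym : ∀ {a b} → Flip a b → Flip b a
    flip-sym {a} {b} f@(la , lb , _) with many (class? a) (la ∘ cov-≤ q≤s)
    ... | xs , xs! , xs-all , xs-len
        with Fin.any? (λ y → class? b y ×-dec All.all? (adj? G y) xs)
    ...   | yes (y , cy , all) = lb , la , y , cy , λ c →
              1+n≰n (subst (_≤ q) xs-len (cov-unique xs! (All.zip (xs-all , all)) c))
    ...   | no ¬e = ⊥-elim (lb (cov-mono missed pq≤s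
              (cov-bind (λ x → Any.any? (x Fin.≟_) xs) (cov-≤ (≤-reflexive xs-len) (cov-∈ xs)) λ x x∈ →
               flip-dense f (All.lookup xs-all x∈))))
      where
      missed : ∀ {y} → Class b y → ∃[ x ] (x ∈ xs × Class b y × ¬ Adj x y)
      missed {y} cy with find (All.¬All⇒Any¬ (adj? G y) xs (λ all → ¬e (y , cy , all)))
      ... | x , x∈ , ¬e′ = x , x∈ , cy , ¬e′ ∘ Adj-sym

    nonflip-sparse : ∀ {a b x} → Large a → Large b → ¬ Flip a b → Class a x →
                     Cov (λ y → Class b y × Adj x y) q
    nonflip-sparse {b = b} {x} la lb ¬f cx with cov? (classAdj? b x) q
    ... | yes c = c
    ... | no ¬c = ⊥-elim (¬f (la , lb , x , cx , ¬c))

    lowAdj? : ∀ x → Decidable (λ y → ¬ High y × Adj x y)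
    lowAdj? x y = ¬? (high? y) ×-dec adj? G x y

    -- Given q + 1 such neighbours, every member of class a would be adjacent to one of them, but
    -- together they have at most (q + 1)k₀ neighbours.
    low-neighbors : ∀ {a x} → Large a → Class a x → Cov (λ y → ¬ High y × Adj x y) q
    low-neighbors {a} {x} la cx with cov? (lowAdj? x) q
    ... | yes c = c
    ... | no ¬c with many (lowAdj? x) ¬c
    ...   | ys , ys! , ys-all , ys-len = ⊥-elim (la (cov-mono adjacent
              (≤-trans (*-monoʳ-≤ (suc q) (m≤m+n k₀ k₀)) pq≤s)
              (cov-bind (λ y → Any.any? (y Fin.≟_) ys) (cov-≤ (≤-reflexive ys-len) (cov-∈ ys)) λ y y∈ →
               low (proj₁ (All.lookup ys-all y∈)))))
      where
      low : ∀ {y} → ¬ High y → Cov (Adj y) k₀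
      low {y} ¬h with cov? (adj? G y) k₀
      ... | yes c = c
      ... | no ¬c′ = ⊥-elim (¬h ¬c′)
      adjacent : ∀ {x′} → Class a x′ → ∃[ y ] (y ∈ ys × Adj y x′)
      adjacent cx′ with find (hit ys! ys-len (All.map proj₂ ys-all) (class-twins cx cx′))
      ... | y , y∈ , e = y , y∈ , Adj-sym e

    class-near : ∀ {a x} → Class a x → Dist≤ G 2 x a
    class-near (h , refl) with common-neighbor G h (rep-twin h)
    ... | w , e , f = dist-trans G (dist-adj G e) (dist-adj G (Adj-sym f))

    flip-near : ∀ {a b} → Flip a b → Dist≤ G 5 a b
    flip-near {b = b} (_ , _ , x , cx , ¬c) with some (classAdj? b x) ¬c
    ... | y , cy , e =
      dist-trans G (dist-sym G (class-near cx)) (dist-trans G (dist-adj G e) (class-near cy))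

    -- Nodes and edges of the hub graph.

    Node : Set
    Node = Vertex ⊎ Vertex

    FlipPair : Vertex → Vertex → Set
    FlipPair x y = High x × High y × Flip (rep x) (rep y)

    flipPair? : ∀ x y → Dec (FlipPair x y)
    flipPair? x y = high? x ×-dec high? y ×-dec flip? (rep x) (rep y)

    flipPair-sym : ∀ {x y} → FlipPair x y → FlipPair y x
    flipPair-sym (hx , hy , f) = hy , hx , flip-sym f

    -- Every vertex gets a hub, so nodes are two copies of the vertex set; the hub is isolated
    -- unless the class is large.
    Edge : Node → Node → Set
    Edge (inj₁ x) (inj₁ y) = x ≢ y × ((Adj x y × ¬ FlipPair x y) ⊎ (¬ Adj x y × FlipPair x y))
    Edge (inj₁ x) (inj₂ a) = Class a x × Large a
    Edge (inj₂ a) (inj₁ x) = Class a x × Large a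
    Edge (inj₂ a) (inj₂ b) = a ≢ b × Flip a b

    edge? : ∀ g h → Dec (Edge g h)
    edge? (inj₁ x) (inj₁ y) = ¬? (x Fin.≟ y) ×-dec
      ((adj? G x y ×-dec ¬? (flipPair? x y)) ⊎-dec (¬? (adj? G x y) ×-dec flipPair? x y))
    edge? (inj₁ x) (inj₂ a) = class? a x ×-dec large? a
    edge? (inj₂ a) (inj₁ x) = class? a x ×-dec large? a
    edge? (inj₂ a) (inj₂ b) = ¬? (a Fin.≟ b) ×-dec flip? a b

    edge-sym : ∀ g h → Edge g h → Edge h g
    edge-sym (inj₁ x) (inj₁ y) (x≢y , inj₁ (e , ¬f)) = ≢-sym x≢y , inj₁ (Adj-sym e , ¬f ∘ flipPair-sym)
    edge-sym (inj₁ x) (inj₁ y) (x≢y , inj₂ (¬e , f)) = ≢-sym x≢y , inj₂ (¬e ∘ Adj-sym , flipPair-sym f)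
    edge-sym (inj₁ x) (inj₂ a) e = e
    edge-sym (inj₂ a) (inj₁ x) e = e
    edge-sym (inj₂ a) (inj₂ b) (a≢b , f) = ≢-sym a≢b , flip-sym f

    edge-irrefl : ∀ g → ¬ Edge g g
    edge-irrefl (inj₁ x) (x≢x , _) = x≢x refl
    edge-irrefl (inj₂ a) (a≢a , _) = a≢a refl

    IsHub : Node → Set
    IsHub h = ∃[ a ] h ≡ inj₂ a

    isHub? : Decidable IsHub
    isHub? (inj₁ x) = no λ ()
    isHub? (inj₂ a) = yes (a , refl)

    -- Hubs carry no loops, so a color records the classes that are complemented within themselves.
    SelfFlip : Node → Set
    SelfFlip h = ∃[ a ] (h ≡ inj₂ a × Flip a a)

    selfFlip? : Decidable SelfFlip
    selfFlip? (inj₁ x) = no λ ()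
    selfFlip? (inj₂ a) with flip? a a
    ... | yes f = yes (a , refl , f)
    ... | no ¬f = no λ { (_ , refl , f) → ¬f f }

    node : Fin (order + order) → Node
    node = splitAt order

    vertex : Node → Fin (order + order)
    vertex = join order order

    node-vertex : ∀ h → node (vertex h) ≡ h
    node-vertex = Fin.splitAt-join order order

    vertex-node : ∀ i → vertex (node i) ≡ i
    vertex-node = Fin.join-splitAt order order

    hubGraph : Graph
    hubGraph = record
      { order      = order + order
      ; adj        = λ i j → ⌊ edge? (node i) (node j) ⌋
      ; Adj-sym    = λ {i} {j} e → fromWitness (edge-sym (node i) (node j) (toWitness e))
      ; Adj-irrefl = λ { {i} refl e → edge-irrefl (node i) (toWitness e) }
      }

    module Hub = Graph hubGraph

    hub-adj⁺ : ∀ {i j} → Edge (node i) (node j) → Hub.Adj i j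
    hub-adj⁺ = fromWitness

    hub-adj⁻ : ∀ {i j} → Hub.Adj i j → Edge (node i) (node j)
    hub-adj⁻ = toWitness

    coloredHubGraph : ColoredGraph 2
    coloredHubGraph = record
      { graph = hubGraph
      ; color = λ { 0F → subset (isHub? ∘ node) ; 1F → subset (selfFlip? ∘ node) }
      }

    base : Node → Vertex
    base (inj₁ x) = x
    base (inj₂ a) = a

    edge-near : ∀ g h → Edge g h → Dist≤ G 9 (base g) (base h)
    edge-near (inj₁ x) (inj₁ y) (_ , inj₁ (e , _)) = dist-mono G (m≤m+n 1 8) (dist-adj G e)
    -- The longest case: 2 to the representative of x, 5 across the flip, 2 back to y.
    edge-near (inj₁ x) (inj₁ y) (_ , inj₂ (_ , hx , hy , f)) =
      dist-trans G (class-near (hx , refl))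
        (dist-trans G (flip-near f) (dist-sym G (class-near (hy , refl))))
    edge-near (inj₁ x) (inj₂ a) (c , _) = dist-mono G (m≤m+n 2 7) (class-near c)
    edge-near (inj₂ a) (inj₁ x) (c , _) = dist-mono G (m≤m+n 2 7) (dist-sym G (class-near c))
    edge-near (inj₂ a) (inj₂ b) (_ , f) = dist-mono G (m≤m+n 5 4) (flip-near f)

    hub-near : ∀ {r i j} → Dist≤ hubGraph r i j → Dist≤ G (r * 9) (base (node i)) (base (node j))
    hub-near = dist-map hubGraph G (base ∘ node) 9 (λ {i} {j} e → edge-near (node i) (node j) (hub-adj⁻ e))

    -- Degrees in the hub graph.

    low-degree : ∀ {x d} → ¬ (High x × Large (rep x)) → Cov (Adj x) d → Cov (Edge (inj₁ x)) d
    low-degree {x} ¬hl c = cov-⊆ neighbor (cov-map inj₁ c)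
      where
      neighbor : ∀ {h} → Edge (inj₁ x) h → ∃[ y ] (Adj x y × h ≡ inj₁ y)
      neighbor {inj₁ y} (_ , inj₁ (e , _))            = y , e , refl
      neighbor {inj₁ y} (_ , inj₂ (_ , h , _ , l , _)) = ⊥-elim (¬hl (h , l))
      neighbor {inj₂ a} ((h , refl) , l)              = ⊥-elim (¬hl (h , l))

    -- Representatives are pairwise not near-twins, so near-covers of balls of radius 9 bound their
    -- number within distance 8. This includes those reached from a class member across a flip, at 2
    -- + 5.
    NearRep : Vertex → Vertex → Set
    NearRep v a = a ∈ reps × Dist≤ G 8 v a

    nearRep? : ∀ v → Decidable (NearRep v)
    nearRep? v a = isRep? a ×-dec dist≤? G 8 v a

    module _ {m₀ : ℕ} (few : ∀ v → Cov (NearRep v) m₀) where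

      -- The neighbours are the own hub, few vertices of low degree, and members of nearby classes:
      -- at most s from a small class, at most q from a large one after complementing.
      large-degree : ∀ {x} → High x → Large (rep x) → Cov (Edge (inj₁ x)) (1 + (q + m₀ * s))
      large-degree {x} hx lx =
        cov-∪ split (cov {P = λ h → h ≡ inj₂ (rep x)} [ inj₂ (rep x) ] ≤-refl here)
          (cov-∪ id (cov-map inj₁ (low-neighbors lx (hx , refl)))
                    (cov-map inj₁ (cov-bind (nearRep? x) (few x) (λ b _ → inClass b))))
        where
        InClass : Vertex → Vertex → Set
        InClass b y = Class b y × Edge (inj₁ x) (inj₁ y)

        inClass : ∀ b → Cov (InClass b) s
        inClass b with large? b
        ... | no ¬l with cov? (class? b) s
        ...   | yes c = cov-⊆ proj₁ c
        ...   | no ¬c = ⊥-elim (¬l ¬c)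
        inClass b | yes l with flip? (rep x) b
        ...   | yes f = cov-mono
                  (λ { (c , _ , inj₂ (¬e , _)) → c , ¬e
                     ; ((hy , refl) , _ , inj₁ (_ , ¬f)) → ⊥-elim (¬f (hx , hy , f)) })
                  q≤s (flip-dense f (hx , refl))
        ...   | no ¬f = cov-mono
                  (λ { (c , _ , inj₁ (e , _)) → c , e
                     ; ((_ , refl) , _ , inj₂ (_ , _ , _ , f)) → ⊥-elim (¬f f) })
                  q≤s (nonflip-sparse lx l ¬f (hx , refl))

        near : ∀ {y} → High y → Edge (inj₁ x) (inj₁ y) → Dist≤ G 8 x (rep y)
        near hy (_ , inj₁ (e , _)) =
          dist-mono G (m≤m+n 3 5) (dist-trans G (dist-adj G e) (class-near (hy , refl)))
        near hy (_ , inj₂ (_ , _ , _ , f)) =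
          dist-mono G (m≤m+n 7 1) (dist-trans G (class-near (hx , refl)) (flip-near f))

        split : ∀ {h} → Edge (inj₁ x) h →
          h ≡ inj₂ (rep x) ⊎
          ((∃[ y ] ((¬ High y × Adj x y) × h ≡ inj₁ y)) ⊎
           (∃[ y ] ((∃[ b ] (NearRep x b × InClass b y)) × h ≡ inj₁ y)))
        split {inj₂ a} ((_ , refl) , _) = inj₁ refl
        split {inj₁ y} e with high? y
        ... | yes hy = inj₂ (inj₂ (y , (rep y , (rep-∈ hy , near hy e) , (hy , refl) , e) , refl))
        split {inj₁ y} (_ , inj₁ (e , _)) | no ¬hy = inj₂ (inj₁ (y , (¬hy , e) , refl))
        split {inj₁ y} (_ , inj₂ (_ , _ , hy , _)) | no ¬hy = ⊥-elim (¬hy hy)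

      hub-degree : ∀ {a c} → Cov (Class a) c → Cov (Edge (inj₂ a)) (c + m₀)
      hub-degree {a} c = cov-∪ split (cov-map inj₁ c) (cov-map inj₂ (few a))
        where
        split : ∀ {h} → Edge (inj₂ a) h →
          (∃[ x ] (Class a x × h ≡ inj₁ x)) ⊎ (∃[ b ] (NearRep a b × h ≡ inj₂ b))
        split {inj₁ x} (cx , _) = inj₁ (x , cx , refl)
        split {inj₂ b} (_ , f@(_ , lb , _)) =
          inj₂ (b , (large-∈ lb , dist-mono G (m≤m+n 5 3) (flip-near f)) , refl)

      module _ {ρ K M : ℕ} (v : Vertex)
               (nc : NearCovered (induced G (ball G (suc (ρ + 4)) v)) K M) where

        Busy : Vertex → Set
        Busy w = Dist≤ G (ρ + 4) v w × ¬ Cov (Adj w) K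

        busy? : Decidable Busy
        busy? w = dist≤? G (ρ + 4) v w ×-dec ¬? (cov? (adj? G w) K)

        BusyRep : Vertex → Set
        BusyRep a = a ∈ reps × ∃[ w ] (Busy w × Dist≤ G 2 w a)

        busyRep? : Decidable BusyRep
        busyRep? a = isRep? a ×-dec Fin.any? (λ w → busy? w ×-dec dist≤? G 2 w a)

        -- K-near-twins of degree more than K share a neighbour, so the
        -- representatives near busy vertices cluster around few vertices.
        few-busyReps : Cov BusyRep (M * m₀)
        few-busyReps = cov-⊆ locate
          (cov-bind (λ w → Any.any? (w Fin.≟_) chosen) few-chosen (λ w _ → few w))
          where
          open MaximalIndependent
            (maximalIndependent {Q = Busy} (twins? G K) busy? (twins-refl G) (twins-sym G))
            using (chosen) renaming (chosen-Q to chosen-busy; independent to chosen-independent; maximal to chosen-maximal)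
          few-chosen : Cov (_∈ chosen) M
          few-chosen = near-covered-ball G nc (λ w → Any.any? (w Fin.≟_) chosen)
            chosen-independent (proj₁ ∘ chosen-busy)
          locate : ∀ {a} → BusyRep a → ∃[ w ] (w ∈ chosen × NearRep w a)
          locate (a∈ , w , bw@(_ , ¬c) , d) with chosen-maximal bw
          ... | w′ , w′∈ , t with common-neighbor G ¬c t
          ...   | u , e , e′ = w′ , w′∈ , a∈ , dist-mono G (m≤m+n 4 4)
                    (dist-trans G (dist-trans G (dist-adj G e′) (dist-adj G (Adj-sym e))) d)

        -- The nodes charged to a representative: its hub and, if its class is small, the members of
        -- the class.
        Owns : Vertex → Node → Set
        Owns a h = h ≡ inj₂ a ⊎ ∃[ x ] ((Class a x × ¬ Large a) × h ≡ inj₁ x)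

        few-owned : ∀ a → Cov (Owns a) (1 + s)
        few-owned a = cov-∪ id (cov {P = λ h → h ≡ inj₂ a} [ inj₂ a ] ≤-refl here) (cov-map inj₁ small)
          where
          small : Cov (λ x → Class a x × ¬ Large a) s
          small with cov? (class? a) s
          ... | yes c = cov-⊆ proj₁ c
          ... | no ¬c = cov-∅ λ { (_ , ¬l) → ¬l ¬c }

        -- Low vertices and members of large classes have bounded degree. A member of a small class
        -- keeps only edges of `G`, so exceeding the bound makes it busy itself.
        busy-owner : ∀ h → Dist≤ G ρ v (base h) → ¬ Cov (Edge h) (degreeBound k₀ m₀ K) → ∃[ a ] (BusyRep a × Owns a h)
        busy-owner (inj₁ x) d ¬c with high? x
        ... | no ¬h with cov? (adj? G x) k₀
        ...   | yes c = ⊥-elim (¬c (cov-≤ (m≤m+n _ _) (low-degree (¬h ∘ proj₁) c)))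
        ...   | no ¬c′ = ⊥-elim (¬h ¬c′)
        busy-owner (inj₁ x) d ¬c | yes h with large? (rep x)
        ...   | yes l = ⊥-elim (¬c (cov-≤ (≤-trans (m≤m+n _ _) (m≤n+m _ k₀)) (large-degree h l)))
        ...   | no ¬l = rep x
                , (rep-∈ h , x , (dist-mono G (m≤m+n ρ 4) d
                    , λ c → ¬c (cov-≤ (≤-trans (≤-trans (m≤m+n K _) (m≤n+m _ (1 + (q + m₀ * s)))) (m≤n+m _ k₀))
                                      (low-degree (¬l ∘ proj₂) c)))
                   , class-near (h , refl))
                , inj₂ (x , ((h , refl) , ¬l) , refl)
        busy-owner (inj₂ a) d ¬c with busyRep? a
        ... | yes b = a , b , inj₁ refl
        ... | no ¬b with isRep? a
        ...   | no a∉ = ⊥-elim (¬c (cov-∅ λ {h} e → a∉ (large-∈ (edge-large h e))))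
          where
          edge-large : ∀ h → Edge (inj₂ a) h → Large a
          edge-large (inj₁ x) (_ , l)     = l
          edge-large (inj₂ b) (_ , l , _) = l
        ...   | yes a∈ = ⊥-elim (¬c (cov-≤
                  (≤-trans (≤-trans (m≤n+m _ K) (m≤n+m _ (1 + (q + m₀ * s)))) (m≤n+m _ k₀))
                  -- Members of the class are two steps from `a`; if neither `a` nor its neighbours
                  -- are busy, there are at most K * K of them.
                  (hub-degree (cov-⊆ through (cov-bind (adj? G a) (idle z≤n (dist-refl G)) (λ w e → idle (s≤s z≤n) (dist-adj G e)))))))
          where
          idle : ∀ {w r} → r ≤ 2 → Dist≤ G r a w → Cov (Adj w) K
          idle {w} r≤2 d′ with cov? (adj? G w) K
          ... | yes c = c
          ... | no ¬c′ = ⊥-elim (¬b (a∈ , w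
                , (dist-mono G (+-monoʳ-≤ ρ (≤-trans r≤2 (m≤m+n 2 2))) (dist-trans G d d′) , ¬c′)
                , dist-mono G r≤2 (dist-sym G d′)))
          through : ∀ {x} → Class a x → ∃[ w ] (Adj a w × Adj w x)
          through (h , refl) with common-neighbor G h (rep-twin h)
          ... | w , e , f = w , f , Adj-sym e

        few-high-degree : Cov (λ h → Dist≤ G ρ v (base h) × ¬ Cov (Edge h) (degreeBound k₀ m₀ K))
                              (M * m₀ * (1 + s))
        few-high-degree = cov-⊆ (λ { {h} (d , ¬c) → busy-owner h d ¬c })
          (cov-bind busyRep? few-busyReps (λ a _ → few-owned a))

      -- Radius r in the hub graph projects to radius 9r in `G`; the search for busy vertices
      -- extends 4 further, and `near-covered-ball` needs one more.
      hub-bounded : ∀ {K M} r i →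
        NearCovered (induced G (ball G (suc (r * 9 + 4)) (base (node i)))) K M →
        Cov (λ j → Dist≤ hubGraph r i j × ¬ Cov (Hub.Adj j) (degreeBound k₀ m₀ K)) (M * m₀ * (1 + s))
      hub-bounded r i nc = cov-⊆
        (λ { {j} (d , ¬c) → node j , (hub-near d , ¬c ∘ lower j) , sym (vertex-node j) })
        (cov-map vertex (few-high-degree (base (node i)) nc))
        where
        lower : ∀ j {c} → Cov (Edge (node j)) c → Cov (Hub.Adj j) c
        lower j c = cov-⊆ (λ {l} e → node l , hub-adj⁻ e , sym (vertex-node l)) (cov-map vertex c)

-- Recovering a graph from its hub graph.

flipᶠ : Formula 2 2
-- Indices 2 and 3 are the free variables, 1 and 0 their hubs. Color 0 marks hubs, color 1 hubs of
-- self-complemented classes.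
flipᶠ = ∃ᶠ (∃ᶠ (edge 2F 1F ∧ᶠ (edge 3F 0F ∧ᶠ (colored 0F 1F ∧ᶠ (colored 0F 0F ∧ᶠ
          (edge 1F 0F ∨ᶠ ((1F ≐ 0F) ∧ᶠ colored 1F 1F)))))))

-- Complementing the same pairs a second time restores the original edges.
edgeᶠ : Formula 2 2
edgeᶠ = (¬ᶠ (0F ≐ 1F)) ∧ᶠ ((edge 0F 1F ∧ᶠ (¬ᶠ flipᶠ)) ∨ᶠ ((¬ᶠ edge 0F 1F) ∧ᶠ flipᶠ))

module _ (H : ColoredGraph 2) where
  open ColoredGraph H

  flipᶠ-sym : ∀ {u v} → Sat₂ H flipᶠ u v → Sat₂ H flipᶠ v u
  flipᶠ-sym (h , g , e , e′ , c , c′ , inj₁ f) = g , h , e′ , e , c′ , c , inj₁ (Adj-sym f)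
  flipᶠ-sym (h , g , e , e′ , c , c′ , inj₂ (refl , f)) = g , h , e′ , e , c′ , c , inj₂ (refl , f)

  edgeᶠ-sym : ∀ {u v} → Sat₂ H edgeᶠ u v → Sat₂ H edgeᶠ v u
  edgeᶠ-sym (u≢v , inj₁ (e , ¬f)) = ≢-sym u≢v , inj₁ (Adj-sym e , ¬f ∘ flipᶠ-sym)
  edgeᶠ-sym (u≢v , inj₂ (¬e , f)) = ≢-sym u≢v , inj₂ (¬e ∘ Adj-sym , flipᶠ-sym f)

  edgeᶠ-near : ∀ {u v} → Sat₂ H edgeᶠ u v → Dist≤ graph 3 u v
  edgeᶠ-near (_ , inj₁ (e , _)) = dist-mono graph (m≤m+n 1 2) (dist-adj graph e)
  edgeᶠ-near (_ , inj₂ (_ , h , g , e , e′ , _ , _ , inj₁ f)) =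
    dist-trans graph (dist-adj graph e)
      (dist-trans graph (dist-adj graph f) (dist-adj graph (Adj-sym e′)))
  edgeᶠ-near (_ , inj₂ (_ , h , g , e , e′ , _ , _ , inj₂ (refl , _))) =
    dist-mono graph (m≤m+n 2 1) (dist-trans graph (dist-adj graph e) (dist-adj graph (Adj-sym e′)))

hubInterpretation : Interpretation 2
hubInterpretation = record
  { ψ        = edgeᶠ
  ; δ        = ¬ᶠ colored 0F 0F
  ; ψ-sym    = λ H → edgeᶠ-sym H
  ; ψ-irrefl = λ { H refl (u≢u , _) → u≢u refl }
  }

module HubInterpretation (G : Graph) (k₀ : ℕ) (R : MaximalIndependent (Twins G k₀) (HubGraph.High G k₀)) where
  open Graph G
  open HubGraph G k₀ hiding (module Hub)

  private
    H : ColoredGraph 2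
    H = coloredHubGraph R

    module H = ColoredGraph H

    ι : Vertex → H.Vertex
    ι x = vertex R (inj₁ x)

    node-ι : ∀ x → node R (ι x) ≡ inj₁ x
    node-ι x = node-vertex R (inj₁ x)

    δ? : Decidable (Sat₁ H (Interpretation.δ hubInterpretation))
    δ? = sat₁? H (Interpretation.δ hubInterpretation)

  adj-vertex⁺ : ∀ g h → Edge R g h → H.Adj (vertex R g) (vertex R h)
  adj-vertex⁺ g h e = hub-adj⁺ R (subst₂ (Edge R) (sym (node-vertex R g)) (sym (node-vertex R h)) e)

  adj-node⁻ : ∀ {i j g h} → node R i ≡ g → node R j ≡ h → H.Adj i j → Edge R g h
  adj-node⁻ refl refl e = hub-adj⁻ R e

  hub-color⁻ : ∀ {i} → i ∈ˢ H.color 0F → IsHub R (node R i)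
  hub-color⁻ = ∈-subset⁻ (isHub? R ∘ node R)

  hub-color⁺ : ∀ a → vertex R (inj₂ a) ∈ˢ H.color 0F
  hub-color⁺ a = ∈-subset⁺ (isHub? R ∘ node R) (a , node-vertex R (inj₂ a))

  flip-ι⁺ : ∀ {x y} → FlipPair R x y → Sat₂ H flipᶠ (ι x) (ι y)
  flip-ι⁺ {x} {y} (hx , hy , f@(lx , ly , _)) =
    vertex R (inj₂ (rep R x)) , vertex R (inj₂ (rep R y)) ,
    adj-vertex⁺ (inj₁ x) (inj₂ _) ((hx , refl) , lx) , adj-vertex⁺ (inj₁ y) (inj₂ _) ((hy , refl) , ly) ,
    hub-color⁺ _ , hub-color⁺ _ , joined
    where
    joined : H.Adj (vertex R (inj₂ (rep R x))) (vertex R (inj₂ (rep R y)))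
         ⊎ (vertex R (inj₂ (rep R x)) ≡ vertex R (inj₂ (rep R y))
            × vertex R (inj₂ (rep R x)) ∈ˢ H.color 1F)
    joined with rep R x Fin.≟ rep R y
    ... | no x≢y = inj₁ (adj-vertex⁺ (inj₂ _) (inj₂ _) (x≢y , f))
    ... | yes eq = inj₂ (cong (vertex R ∘ inj₂) eq ,
                     ∈-subset⁺ (selfFlip? R ∘ node R)
                       (_ , node-vertex R _ , subst (Flip R _) (sym eq) f))

  -- A hub adjacent to `ι x` is the hub of the class of x, so the hubs chosen by the formula are
  -- determined by x and y.
  flip-ι⁻ : ∀ {x y} → Sat₂ H flipᶠ (ι x) (ι y) → FlipPair R x y
  flip-ι⁻ {x} {y} (h , g , e , e′ , c , c′ , joined) with hub-color⁻ c | hub-color⁻ c′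
  ... | a , eqa | b , eqb with adj-node⁻ (node-ι x) eqa e | adj-node⁻ (node-ι y) eqb e′
  ...   | (hx , refl) , _ | (hy , refl) , _ = hx , hy , flipped joined
    where
    flipped : H.Adj h g ⊎ (h ≡ g × h ∈ˢ H.color 1F) → Flip R (rep R x) (rep R y)
    flipped (inj₁ f) = proj₂ (adj-node⁻ eqa eqb f)
    flipped (inj₂ (refl , s∈)) with ∈-subset⁻ (selfFlip? R ∘ node R) s∈
    ... | d , eqd , f with inj₂-injective (trans (sym eqa) eqb) | inj₂-injective (trans (sym eqd) eqa)
    ...   | xy | refl = subst (Flip R (rep R x)) xy f

  edge-ι⁺ : ∀ {x y} → Adj x y → Sat₂ H edgeᶠ (ι x) (ι y)
  edge-ι⁺ {x} {y} e = ι≢ , sat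
    where
    x≢y : x ≢ y
    x≢y eq = Adj-irrefl eq e
    ι≢ : ι x ≢ ι y
    ι≢ eq = x≢y (inj₁-injective (trans (sym (node-ι x)) (trans (cong (node R) eq) (node-ι y))))
    sat : (H.Adj (ι x) (ι y) × ¬ Sat₂ H flipᶠ (ι x) (ι y))
        ⊎ (¬ H.Adj (ι x) (ι y) × Sat₂ H flipᶠ (ι x) (ι y))
    sat with flipPair? R x y
    ... | no ¬f = inj₁ (adj-vertex⁺ (inj₁ _) (inj₁ _) (x≢y , inj₁ (e , ¬f)) , ¬f ∘ flip-ι⁻)
    ... | yes f = inj₂ ((λ e′ → nonadjacent (adj-node⁻ (node-ι x) (node-ι y) e′)) , flip-ι⁺ f)
      where
      nonadjacent : ¬ Edge R (inj₁ x) (inj₁ y)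
      nonadjacent (_ , inj₁ (_ , ¬f)) = ¬f f
      nonadjacent (_ , inj₂ (¬e , _)) = ¬e e

  edge-ι⁻ : ∀ {x y} → Sat₂ H edgeᶠ (ι x) (ι y) → Adj x y
  edge-ι⁻ {x} {y} (_ , inj₁ (e , ¬f)) with adj-node⁻ (node-ι x) (node-ι y) e
  ... | _ , inj₁ (e′ , _) = e′
  ... | _ , inj₂ (_ , f)  = ⊥-elim (¬f (flip-ι⁺ f))
  edge-ι⁻ {x} {y} (ι≢ , inj₂ (¬e , f)) with adj? G x y
  ... | yes e = e
  ... | no ¬e′ = ⊥-elim (¬e (adj-vertex⁺ (inj₁ _) (inj₁ _) (ι≢ ∘ cong ι , inj₂ (¬e′ , flip-ι⁻ f))))

  hub-iso : G ≅ interpret hubInterpretation H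
  hub-iso = mk↔ₛ′ to from to-from from-to ,
    λ u v → mk⇔
      (λ e → graphOn-Adj⁺ δ? (sat₂? H edgeᶠ) (edgeᶠ-sym H) (Interpretation.ψ-irrefl hubInterpretation H) (to u) (to v)
               (subst₂ (Sat₂ H edgeᶠ) (sym (at-to u)) (sym (at-to v)) (edge-ι⁺ e)))
      (λ e → edge-ι⁻ (subst₂ (Sat₂ H edgeᶠ) (at-to u) (at-to v)
               (graphOn-Adj⁻ δ? (sat₂? H edgeᶠ) (edgeᶠ-sym H) (Interpretation.ψ-irrefl hubInterpretation H) (to u) (to v) e)))
    where
    I : Graph
    I = interpret hubInterpretation H

    ι-real : ∀ x → ¬ (ι x ∈ˢ H.color 0F)
    ι-real x x∈ with hub-color⁻ x∈
    ... | a , eq with trans (sym (node-ι x)) eq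
    ...   | ()

    to : Vertex → Graph.Vertex I
    to x = proj₁ (vertexAt-surjective δ? {ι x} (ι-real x))

    at-to : ∀ x → vertexAt δ? (to x) ≡ ι x
    at-to x = proj₂ (vertexAt-surjective δ? {ι x} (ι-real x))

    real : ∀ i → ¬ (i ∈ˢ H.color 0F) → ∃[ x ] ι x ≡ i
    real i i∉ with node R i in eq
    ... | inj₁ x = x , trans (cong (vertex R) (sym eq)) (vertex-node R i)
    ... | inj₂ a = ⊥-elim (i∉ (∈-subset⁺ (isHub? R ∘ node R) (a , eq)))

    from : Graph.Vertex I → Vertex
    from i = proj₁ (real (vertexAt δ? i) (vertexAt-P δ? i))

    ι-from : ∀ i → ι (from i) ≡ vertexAt δ? i
    ι-from i = proj₂ (real (vertexAt δ? i) (vertexAt-P δ? i))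

    to-from : ∀ i → to (from i) ≡ i
    to-from i = vertexAt-injective δ? (trans (at-to (from i)) (ι-from i))

    from-to : ∀ x → from (to x) ≡ x
    from-to x = inj₁-injective (trans (sym (node-ι _))
      (trans (cong (node R) (trans (ι-from (to x)) (at-to x))) (node-ι x)))

interpretable : (C : GraphClass ℓ) → LocallyAlmostNearCovered C →
  ∃[ p ] Σ[ D ∈ ColoredGraphClass p ℓ ] Σ[ I ∈ Interpretation p ]
    (LocallyAlmostBoundedDegree D × BoundedRange I
     × (∀ G → C G → ∃[ H ] (D H × G ≅ interpret I H)))
interpretable {ℓ} C (k , m , nc) =
  2 , D , hubInterpretation ,
  -- The hub graph must not depend on r: its constants come from radius 9, and only the near-cover
  -- for busy vertices varies with r.
  ( (λ r → m (suc (r * 9 + 4)) * m 9 * (1 + classBound (k 9)))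
  , (λ r → degreeBound (k 9) (m 9) (k (suc (r * 9 + 4))))
  , bounded) ,
  (3 , λ H u v far sat → far (edgeᶠ-near H sat)) ,
  λ G c → hub G , (G , c , refl) , HubInterpretation.hub-iso G (k 9) (reps G)
  where
  reps : ∀ G → MaximalIndependent (Twins G (k 9)) (HubGraph.High G (k 9))
  reps G = maximalIndependent (twins? G (k 9)) (HubGraph.high? G (k 9)) (twins-refl G) (twins-sym G)

  hub : Graph → ColoredGraph 2
  hub G = HubGraph.coloredHubGraph G (k 9) (reps G)

  D : ColoredGraphClass 2 ℓ
  D H = Σ[ G ∈ Graph ] (C G × H ≡ hub G)

  few : ∀ G → C G → ∀ v → Cov (HubGraph.NearRep G (k 9) (reps G) v) (m 9)
  few G c v = near-covered-ball G (nc 9 G c v) (HubGraph.nearRep? G (k 9) (reps G) v)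
    (λ a b → independent (proj₁ a) (proj₁ b)) proj₂
    where open MaximalIndependent (reps G)

  bounded : ∀ r H → D H → ∀ v →
    ∣ ball (ColoredGraph.graph H) r v ∩ degreeAbove (ColoredGraph.graph H) (degreeBound (k 9) (m 9) (k (suc (r * 9 + 4)))) ∣
      ≤ m (suc (r * 9 + 4)) * m 9 * (1 + classBound (k 9))
  bounded r _ (G , c , refl) v = cov⇒∣∣ _ (cov-⊆
    (λ x∈ → let b , d = x∈p∩q⁻ _ _ x∈ in ∈-ball⁻ H b , ∈-degreeAbove⁻ H d)
    (HubGraph.hub-bounded G (k 9) (reps G) (few G c) r v (nc _ G c _)))
    where
    H : Graph
    H = HubGraph.hubGraph G (k 9) (reps G)

theorem5p8 : ∀ {ℓ} (C : GraphClass ℓ) →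
    (∃[ p ] Σ[ D ∈ ColoredGraphClass p ℓ ] Σ[ I ∈ Interpretation p ]
    (LocallyAlmostBoundedDegree D
    × BoundedRange I
    × (∀ G → C G → ∃[ H ] (D H × G ≅ interpret I H))))
    ⇔ LocallyAlmostNearCovered C
theorem5p8 C = mk⇔
  (λ { (p , D , I , (f , d , bounded) , (b , range) , interpreted) →
       interpretation-twins I range f d , interpretation-classes I range f d ,
       λ r G c v → let H , h , iso = interpreted G c in
         interpretation-near-covered I range f d G H (λ r′ → bounded r′ H h) iso r v })
  (interpretable C)
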